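{- For every integer $r \geq 3$ and every $\alpha>0$, there exists $C=C(r,\alpha)>0$ such that for every $\varepsilon>0$, \[ \delta\left(\varepsilon,K_r;\frac{2r-5}{2r-3}- \alpha\right) \leq \delta (C\varepsilon, K_3). \] In particular, for every fixed $\gamma<\frac{2r-5}{2r-3}$, $\delta(\varepsilon, K_r; \gamma)^{ -1}$ is super-polynomial in $\varepsilon^{ -1}$ (i.e. there is no $\mu>0$ with $\delta(\varepsilon,K_r;\gamma)\geq \mu\varepsilon^{1/\mu}$ for all $\varepsilon\in(0,1)$).
   Context: For a graph $H$ on $h$ vertices, $\varepsilon>0$ and real $\gamma$, $\delta(\varepsilon,H;\gamma)$ denotes the maximum $\delta\in[0,1]$ such that, for every $n$, every $n$-vertex graph with fewer than $\delta n^h$ copies of $H$ (subgraphs isomorphic to $H$) and minimum degree at least $\gamma n$ can be made $H$-free by deleting at most $\varepsilon n^2$ edges. Also $\delta(\varepsilon,H)=\delta(\varepsilon,H;0)$ (no minimum degree condition). $K_r$ is the complete graph on $r$ vertices. -}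

module Defs where

open import Data.Bool using (Bool; true; false; _∧_; T)
open import Data.Nat as ℕ using (ℕ; zero; suc)
open import Data.Fin using (Fin)
import Data.Fin as Fin
open import Data.List using (List; []; _∷_; map; _++_; length; filterᵇ; allFin)
open import Data.Integer using (+_)
open import Data.Rational using (ℚ; _/_; _*_; _-_; _≤_; _<_; 1ℚ)
open import Data.Product using (Σ; _×_)
open import Relation.Binary.PropositionalEquality using (_≡_)

record Graph (n : ℕ) : Set where
  field
    adj   : Fin n → Fin n → Bool
    sym   : ∀ i j → adj i j ≡ adj j i
    irrefl : ∀ i → adj i i ≡ false
open Graph public

_⊆G_ : ∀ {n} → Graph n → Graph n → Set
G' ⊆G G = ∀ i j → T (adj G' i j) → T (adj G i j)

-- k-element subsets of Fin n, as strictly increasing lists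

combs : (n k : ℕ) → List (List (Fin n))
combs n zero = [] ∷ []
combs zero (suc k) = []
combs (suc n) (suc k) =
  map (λ xs → Fin.zero ∷ map Fin.suc xs) (combs n k) ++ map (map Fin.suc) (combs n (suc k))

allᵇ : ∀ {A : Set} → (A → Bool) → List A → Bool
allᵇ p [] = true
allᵇ p (x ∷ xs) = p x ∧ allᵇ p xs

isCliqueᵇ : ∀ {n} → Graph n → List (Fin n) → Bool
isCliqueᵇ G [] = true
isCliqueᵇ G (x ∷ xs) = allᵇ (adj G x) xs ∧ isCliqueᵇ G xs

-- number of copies of K_r in G (a copy of K_r is determined by its r-element vertex set)
copiesK : ∀ {n} → ℕ → Graph n → ℕ
copiesK {n} r G = length (filterᵇ (isCliqueᵇ G) (combs n r))

edges : ∀ {n} → Graph n → ℕ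
edges G = copiesK 2 G

deg : ∀ {n} → Graph n → Fin n → ℕ
deg {n} G v = length (filterᵇ (adj G v) (allFin n))

ℕ→ℚ : ℕ → ℚ
ℕ→ℚ m = + m / 1

infixr 8 _^ℚ_
_^ℚ_ : ℚ → ℕ → ℚ
q ^ℚ zero = 1ℚ
q ^ℚ suc k = q * (q ^ℚ k)

-- RemovalProp r ε γ δ : "every n-vertex graph with fewer than δ n^r copies of K_r
-- and minimum degree at least γ n can be made K_r-free by deleting at most ε n²
-- edges".  By definition δ(ε,K_r;γ) is the maximum δ ∈ [0,1] with this property;
-- the property is downward closed in δ, so "δ ≤ δ(ε,K_r;γ)" ⇔ RemovalProp r ε γ δ
-- (for δ ∈ [0,1]).

RemovalProp : ℕ → ℚ → ℚ → ℚ → Set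
RemovalProp r ε γ δ =
  ∀ (n : ℕ) (G : Graph n) →
  ℕ→ℚ (copiesK r G) < δ * (ℕ→ℚ n ^ℚ r) →
  (∀ v → γ * ℕ→ℚ n ≤ ℕ→ℚ (deg G v)) →
  Σ (Graph n) λ G' → (G' ⊆G G) × (copiesK r G' ≡ 0)
     × (ℕ→ℚ (edges G ℕ.∸ edges G') ≤ ε * (ℕ→ℚ n ^ℚ 2))

-- "δ(ε,K_r;γ) ≤ δ(ε',K_s;γ')", expressed through the defining property:
-- every admissible δ ∈ [0,1] for the left is admissible for the right.
δ≤δ : (r : ℕ) (ε γ : ℚ) (s : ℕ) (ε' γ' : ℚ) → Set
δ≤δ r ε γ s ε' γ' = ∀ (δ : ℚ) → ℕ→ℚ 0 ≤ δ → δ ≤ 1ℚ → RemovalProp r ε γ δ → RemovalProp s ε' γ' δ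

-- the threshold (2r-5)/(2r-3)  (for r ≥ 3, suc (2r ∸ 4) = 2r - 3)
thr : ℕ → ℚ
thr r = + (2 ℕ.* r ℕ.∸ 5) / suc (2 ℕ.* r ℕ.∸ 4)

-- Let G have n vertices and few triangles.  Three copies of V(G), with edges of G only between
-- different copies, together with w = Kn further vertices for each copy, adjacent to that whole copy
-- and otherwise spanning a bipartite graph, form a K₄-free graph B of minimum degree about |B|/3 whose
-- triangles all come from G.  Joining B with r − 3 independent sets of size 2w raises the minimum
-- degree ratio to (2r−5)/(2r−3), up to an error O(1/K), and every copy of K_r uses one vertex from each
-- set and a triangle of B.  Conversely, if the result is made K_r-free, the neighbourhood of the vertex
-- of an independent set that lost the fewest edges is nearly everything and K_{r−1}-free; peeling off
-- the sets one by one gives a triangle-free B' ⊆ B, and the edges of G all of whose six copies survive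
-- in B' form a triangle-free subgraph of G.  All losses are constant factors.
--
-- For the second part, a set of integers without three-term progressions (Behrend) gives a
-- Ruzsa–Szemerédi graph with at most N² triangles that needs a large number of deletions.  With digit
-- vectors of fixed length m and digit bound d → ∞, its density is of order d⁻² (for fixed m), while
-- N exceeds d^m; taking m large in terms of k defeats any bound ε^k / k.
module Submission where

open import Defs hiding (sym)
open import Data.Bool using (Bool; true; false; _∧_; _xor_; not; T) renaming (_≟_ to _≟ᵇ_)
open import Data.Bool.Properties using (∧-assoc; ∧-comm; ∧-zeroʳ; xor-comm; xor-same)
open import Data.Nat
open import Data.Nat.Properties
open import Data.Nat.DivMod using (_%_; [m+kn]%n≡m%n; m<n⇒m%n≡m)
open import Data.Nat.Tactic.RingSolver using (solve-∀)
open import Data.Fin using (Fin; zero; suc; _↑ˡ_; _↑ʳ_; combine; remQuot; splitAt; toℕ; fromℕ<)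
open import Data.Fin.Properties 
  using (splitAt⁻¹-↑ˡ; splitAt⁻¹-↑ʳ; splitAt-↑ˡ; splitAt-↑ʳ; remQuot-combine; combine-remQuot;
         combine-injective; toℕ-injective; toℕ-fromℕ<; toℕ<n; all?; any?)
  renaming (suc-injective to Fin-suc-injective)
open import Data.List using (List; []; _∷_; map; _++_; length; filterᵇ)
import Data.List as List
open import Data.Empty using (⊥; ⊥-elim)
open import Data.Unit using (tt)
open import Data.Product using (Σ; _×_; _,_; proj₁; proj₂; ∃-syntax)
open import Data.Sum using (_⊎_; inj₁; inj₂)
open import Relation.Nullary using (¬_; contradiction; yes; no)
open import Relation.Nullary.Decidable using (toWitness; fromWitness; ⌊_⌋)
open import Function using (_∘_; id)
open import Relation.Binary.PropositionalEquality
  using (_≡_; _≢_; refl; sym; trans; cong; cong₂; subst; module ≡-Reasoning)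
open import Algebra.Properties.Semiring.Sum +-*-semiring
  using (sum; sum-cong-≗; ∑-distrib-+; ∑-comm; *-distribˡ-sum; *-distribʳ-sum; sum-replicate-zero)
open import Data.Integer as ℤ using (+[1+_])
import Data.Integer.Properties as ℤ
open import Data.Rational as ℚ using (ℚ; 0ℚ; 1ℚ; mkℚ; toℚᵘ)
import Data.Rational.Properties as ℚ
import Data.Rational.Unnormalised as ℚᵘ
import Data.Rational.Unnormalised.Properties as ℚᵘ
import Data.Rational.Solver as ℚ

-- Counting cliques

∑-mono : ∀ {n} {f g : Fin n → ℕ} → (∀ i → f i ≤ g i) → sum f ≤ sum g
∑-mono {zero} f≤g = z≤n
∑-mono {suc n} f≤g = +-mono-≤ (f≤g zero) (∑-mono (f≤g ∘ suc))

∑-const : ∀ n c → sum {n} (λ _ → c) ≡ n * c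
∑-const zero c = refl
∑-const (suc n) c = cong (c +_) (∑-const n c)

∑-zero : ∀ {n} {f : Fin n → ℕ} → (∀ i → f i ≡ 0) → sum f ≡ 0
∑-zero {n} f≡0 = trans (sum-cong-≗ f≡0) (sum-replicate-zero n)

∑-≡0⁻ : ∀ {n} (f : Fin n → ℕ) → sum f ≡ 0 → ∀ i → f i ≡ 0
∑-≡0⁻ f eq zero = m+n≡0⇒m≡0 _ eq
∑-≡0⁻ f eq (suc i) = ∑-≡0⁻ (f ∘ suc) (m+n≡0⇒n≡0 (f zero) eq) i

∑-↑ : ∀ m {n} (f : Fin (m + n) → ℕ) → sum f ≡ sum (f ∘ (_↑ˡ n)) + sum (f ∘ (m ↑ʳ_))
∑-↑ zero f = refl
∑-↑ (suc m) f = trans (cong (f zero +_) (∑-↑ m (f ∘ suc))) (sym (+-assoc (f zero) _ _))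

∑-combine : ∀ m {n} (f : Fin (m * n) → ℕ) → sum f ≡ sum λ i → sum λ j → f (combine {m} i j)
∑-combine zero f = refl
∑-combine (suc m) {n} f =
  trans (∑-↑ n f) (cong (sum (f ∘ (_↑ˡ (m * n))) +_) (∑-combine m (f ∘ (n ↑ʳ_))))

𝟙 : Bool → ℕ
𝟙 true = 1
𝟙 false = 0

𝟙-∧ : ∀ b c → 𝟙 (b ∧ c) ≡ 𝟙 b * 𝟙 c
𝟙-∧ true c = sym (+-identityʳ _)
𝟙-∧ false c = refl

𝟙-mono : ∀ {b c} → (T b → T c) → 𝟙 b ≤ 𝟙 c
𝟙-mono {false} h = z≤n
𝟙-mono {true} {true} h = ≤-refl
𝟙-mono {true} {false} h with () ← h _

count : ∀ {A : Set} → (A → Bool) → List A → ℕ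
count p xs = length (filterᵇ p xs)

count-∷ : ∀ {A : Set} (p : A → Bool) x xs → count p (x ∷ xs) ≡ 𝟙 (p x) + count p xs
count-∷ p x xs with p x
... | true = refl
... | false = refl

count-cong : ∀ {A : Set} {p q : A → Bool} → (∀ x → p x ≡ q x) → ∀ xs → count p xs ≡ count q xs
count-cong h [] = refl
count-cong {p = p} {q} h (x ∷ xs) = begin
  count p (x ∷ xs)         ≡⟨ count-∷ p x xs ⟩
  𝟙 (p x) + count p xs     ≡⟨ cong₂ (λ b c → 𝟙 b + c) (h x) (count-cong h xs) ⟩
  𝟙 (q x) + count q xs     ≡⟨ count-∷ q x xs ⟨
  count q (x ∷ xs)         ∎
  where open ≡-Reasoning

count-map : ∀ {A B : Set} (p : B → Bool) (f : A → B) xs → count p (map f xs) ≡ count (p ∘ f) xs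
count-map p f [] = refl
count-map p f (x ∷ xs) = begin
  count p (f x ∷ map f xs)         ≡⟨ count-∷ p (f x) (map f xs) ⟩
  𝟙 (p (f x)) + count p (map f xs) ≡⟨ cong (𝟙 (p (f x)) +_) (count-map p f xs) ⟩
  𝟙 (p (f x)) + count (p ∘ f) xs   ≡⟨ count-∷ (p ∘ f) x xs ⟨
  count (p ∘ f) (x ∷ xs)           ∎
  where open ≡-Reasoning

count-++ : ∀ {A : Set} (p : A → Bool) xs ys → count p (xs ++ ys) ≡ count p xs + count p ys
count-++ p [] ys = refl
count-++ p (x ∷ xs) ys = begin
  count p (x ∷ xs ++ ys)                ≡⟨ count-∷ p x (xs ++ ys) ⟩
  𝟙 (p x) + count p (xs ++ ys)          ≡⟨ cong (𝟙 (p x) +_) (count-++ p xs ys) ⟩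
  𝟙 (p x) + (count p xs + count p ys)   ≡⟨ +-assoc (𝟙 (p x)) _ _ ⟨
  𝟙 (p x) + count p xs + count p ys     ≡⟨ cong (_+ count p ys) (count-∷ p x xs) ⟨
  count p (x ∷ xs) + count p ys         ∎
  where open ≡-Reasoning

count-const∧ : ∀ {A : Set} b (p : A → Bool) xs → count (λ x → b ∧ p x) xs ≡ 𝟙 b * count p xs
count-const∧ true p xs = sym (+-identityʳ _)
count-const∧ false p [] = refl
count-const∧ false p (x ∷ xs) = count-const∧ false p xs

count-tabulate : ∀ {A : Set} {n} (p : A → Bool) (f : Fin n → A) →
  count p (List.tabulate f) ≡ sum (𝟙 ∘ p ∘ f)
count-tabulate {n = zero} p f = refl
count-tabulate {n = suc n} p f =
  trans (count-∷ p (f zero) _) (cong (𝟙 (p (f zero)) +_) (count-tabulate p (f ∘ suc)))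

deg-∑ : ∀ {n} (G : Graph n) v → deg G v ≡ sum (𝟙 ∘ adj G v)
deg-∑ G v = count-tabulate (adj G v) id

deleteFirst : ∀ {n} → Graph (suc n) → Graph n
deleteFirst G = record
  { adj = λ i j → adj G (suc i) (suc j)
  ; sym = λ i j → Graph.sym G (suc i) (suc j)
  ; irrefl = λ i → irrefl G (suc i) }

allᵇ-map : ∀ {A B : Set} (p : B → Bool) (f : A → B) xs → allᵇ p (map f xs) ≡ allᵇ (p ∘ f) xs
allᵇ-map p f [] = refl
allᵇ-map p f (x ∷ xs) = cong (p (f x) ∧_) (allᵇ-map p f xs)

∧-interchange : ∀ a b c d → (a ∧ b) ∧ (c ∧ d) ≡ (a ∧ c) ∧ (b ∧ d)
∧-interchange false b c d = refl
∧-interchange true false false d = refl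
∧-interchange true false true d = refl
∧-interchange true true c d = refl

allᵇ-∧ : ∀ {A : Set} (p q : A → Bool) xs → allᵇ (λ x → p x ∧ q x) xs ≡ allᵇ p xs ∧ allᵇ q xs
allᵇ-∧ p q [] = refl
allᵇ-∧ p q (x ∷ xs) =
  trans (cong ((p x ∧ q x) ∧_) (allᵇ-∧ p q xs)) (∧-interchange (p x) (q x) _ _)

isClique-map-suc : ∀ {n} (G : Graph (suc n)) xs →
  isCliqueᵇ G (map suc xs) ≡ isCliqueᵇ (deleteFirst G) xs
isClique-map-suc G [] = refl
isClique-map-suc G (x ∷ xs) =
  cong₂ _∧_ (allᵇ-map (adj G (suc x)) suc xs) (isClique-map-suc G xs)

-- `S` accumulates the adjacency constraints of the vertices already chosen, so the recursion on the
-- first vertex carries no list of them and runs parallel to `combs`.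
cliquesIn : ∀ {n} → Graph n → ℕ → (Fin n → Bool) → ℕ
cliquesIn G zero S = 1
cliquesIn {zero} G (suc k) S = 0
cliquesIn {suc n} G (suc k) S =
  𝟙 (S zero) * cliquesIn (deleteFirst G) k (λ i → S (suc i) ∧ adj G zero (suc i))
  + cliquesIn (deleteFirst G) (suc k) (S ∘ suc)

cliquesIn-cong : ∀ {n} (G : Graph n) k {S S' : Fin n → Bool} → (∀ i → S i ≡ S' i) →
  cliquesIn G k S ≡ cliquesIn G k S'
cliquesIn-cong G zero h = refl
cliquesIn-cong {zero} G (suc k) h = refl
cliquesIn-cong {suc n} G (suc k) h = cong₂ _+_
  (cong₂ (λ b c → 𝟙 b * c) (h zero)
    (cliquesIn-cong (deleteFirst G) k (λ i → cong (_∧ adj G zero (suc i)) (h (suc i)))))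
  (cliquesIn-cong (deleteFirst G) (suc k) (h ∘ suc))

-- The two halves of `combs`, lists beginning with `zero` and shifted lists, match the two summands
-- of `cliquesIn`. In the first half the adjacency to `zero` moves from the clique test into the
-- set.
count-combs : ∀ {n} (G : Graph n) k (S : Fin n → Bool) →
  count (λ xs → allᵇ S xs ∧ isCliqueᵇ G xs) (combs n k) ≡ cliquesIn G k S
count-combs {zero} G zero S = refl
count-combs {suc n} G zero S = refl
count-combs {zero} G (suc k) S = refl
count-combs {suc n} G (suc k) S = begin
  count p (map consZero (combs n k) ++ map (map suc) (combs n (suc k)))
    ≡⟨ count-++ p (map consZero (combs n k)) _ ⟩
  count p (map consZero (combs n k)) + count p (map (map suc) (combs n (suc k)))
    ≡⟨ cong₂ _+_ (count-map p consZero (combs n k)) (count-map p (map suc) (combs n (suc k))) ⟩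
  count (p ∘ consZero) (combs n k) + count (p ∘ map suc) (combs n (suc k))
    ≡⟨ cong₂ _+_ (count-cong with-first (combs n k)) (count-cong without-first (combs n (suc k))) ⟩
  count (λ xs → S zero ∧ (allᵇ S₀ xs ∧ isCliqueᵇ G' xs)) (combs n k)
    + count (λ xs → allᵇ (S ∘ suc) xs ∧ isCliqueᵇ G' xs) (combs n (suc k))
    ≡⟨ cong₂ _+_ (trans (count-const∧ (S zero) _ (combs n k))
         (cong (𝟙 (S zero) *_) (count-combs G' k S₀))) (count-combs G' (suc k) (S ∘ suc)) ⟩
  𝟙 (S zero) * cliquesIn G' k S₀ + cliquesIn G' (suc k) (S ∘ suc) ∎
  where
  open ≡-Reasoning
  G' = deleteFirst G
  S₀ = λ i → S (suc i) ∧ adj G zero (suc i)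
  p = λ xs → allᵇ S xs ∧ isCliqueᵇ G xs
  consZero : List (Fin n) → List (Fin (suc n))
  consZero xs = zero ∷ map suc xs
  without-first : ∀ xs → p (map suc xs) ≡ allᵇ (S ∘ suc) xs ∧ isCliqueᵇ G' xs
  without-first xs = cong₂ _∧_ (allᵇ-map S suc xs) (isClique-map-suc G xs)
  with-first : ∀ xs → p (consZero xs) ≡ S zero ∧ (allᵇ S₀ xs ∧ isCliqueᵇ G' xs)
  with-first xs = begin
    (S zero ∧ allᵇ S (map suc xs)) ∧ (allᵇ (adj G zero) (map suc xs) ∧ isCliqueᵇ G (map suc xs))
      ≡⟨ cong₂ (λ b c → (S zero ∧ b) ∧ c) (allᵇ-map S suc xs)
           (cong₂ _∧_ (allᵇ-map (adj G zero) suc xs) (isClique-map-suc G xs)) ⟩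
    (S zero ∧ allᵇ (S ∘ suc) xs) ∧ (allᵇ (adj G zero ∘ suc) xs ∧ isCliqueᵇ G' xs)
      ≡⟨ trans (∧-assoc (S zero) _ _) (cong (S zero ∧_) (sym (∧-assoc (allᵇ (S ∘ suc) xs) _ _))) ⟩
    S zero ∧ ((allᵇ (S ∘ suc) xs ∧ allᵇ (adj G zero ∘ suc) xs) ∧ isCliqueᵇ G' xs)
      ≡⟨ cong (λ b → S zero ∧ (b ∧ isCliqueᵇ G' xs)) (allᵇ-∧ (S ∘ suc) (adj G zero ∘ suc) xs) ⟨
    S zero ∧ (allᵇ S₀ xs ∧ isCliqueᵇ G' xs) ∎

allᵇ-true : ∀ {A : Set} (xs : List A) → allᵇ (λ _ → true) xs ≡ true
allᵇ-true [] = refl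
allᵇ-true (x ∷ xs) = allᵇ-true xs

copiesK-cliquesIn : ∀ {n} k (G : Graph n) → copiesK k G ≡ cliquesIn G k (λ _ → true)
copiesK-cliquesIn {n} k G = trans
  (count-cong (λ xs → cong (_∧ isCliqueᵇ G xs) (sym (allᵇ-true xs))) (combs n k))
  (count-combs G k (λ _ → true))

-- A vertex is not its own neighbour, so the summand that uses the first vertex vanishes.
cliquesIn-nbhd-first : ∀ {n} (G : Graph (suc n)) k (S : Fin (suc n) → Bool) →
  cliquesIn G k (λ i → S i ∧ adj G zero i)
  ≡ cliquesIn (deleteFirst G) k (λ i → S (suc i) ∧ adj G zero (suc i))
cliquesIn-nbhd-first G zero S = refl
cliquesIn-nbhd-first G (suc k) S
  rewrite irrefl G zero | ∧-zeroʳ (S zero) = refl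

-- Double counting of pairs of a clique and a distinguished vertex of it. In the induction on `n`, a
-- clique through the first vertex counts once for that vertex and once for each of the others.
*-cliquesIn : ∀ {n} (G : Graph n) k (S : Fin n → Bool) →
  suc k * cliquesIn G (suc k) S ≡ sum λ v → 𝟙 (S v) * cliquesIn G k (λ i → S i ∧ adj G v i)
*-cliquesIn {zero} G k S = *-zeroʳ k
*-cliquesIn {suc n} G zero S = begin
  1 * (𝟙 (S zero) * 1 + cliquesIn G' 1 (S ∘ suc))
    ≡⟨ *-distribˡ-+ 1 (𝟙 (S zero) * 1) _ ⟩
  1 * (𝟙 (S zero) * 1) + 1 * cliquesIn G' 1 (S ∘ suc)
    ≡⟨ cong₂ _+_ (*-identityˡ (𝟙 (S zero) * 1)) (*-cliquesIn G' zero (S ∘ suc)) ⟩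
  𝟙 (S zero) * 1 + sum (λ v → 𝟙 (S (suc v)) * 1) ∎
  where
  open ≡-Reasoning
  G' = deleteFirst G
*-cliquesIn {suc n} G (suc k) S = begin
  suc (suc k) * (s * cliquesIn G' (suc k) S₀ + cliquesIn G' (suc (suc k)) S⁺)
    ≡⟨ regroup (suc k) s (cliquesIn G' (suc k) S₀) (cliquesIn G' (suc (suc k)) S⁺) ⟩
  s * cliquesIn G' (suc k) S₀
    + (s * (suc k * cliquesIn G' (suc k) S₀) + suc (suc k) * cliquesIn G' (suc (suc k)) S⁺)
    ≡⟨ cong₂ _+_ (cong (s *_) (sym (cliquesIn-nbhd-first G (suc k) S)))
         (cong₂ _+_ through-first (*-cliquesIn G' (suc k) S⁺)) ⟩
  s * cliquesIn G (suc k) (λ i → S i ∧ adj G zero i)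
    + (sum (λ v → 𝟙 (S⁺ v) * (𝟙 (S zero ∧ adj G (suc v) zero) *
          cliquesIn G' k (λ i → (S⁺ i ∧ adj G' v i) ∧ adj G zero (suc i))))
      + sum (λ v → 𝟙 (S⁺ v) * cliquesIn G' (suc k) (λ i → S⁺ i ∧ adj G' v i)))
    ≡⟨ cong (s * cliquesIn G (suc k) (λ i → S i ∧ adj G zero i) +_)
         (trans (sym (∑-distrib-+ {n} _ _))
           (sum-cong-≗ λ v → sym (*-distribˡ-+ (𝟙 (S⁺ v)) _ _))) ⟩
  s * cliquesIn G (suc k) (λ i → S i ∧ adj G zero i)
    + sum (λ v → 𝟙 (S⁺ v) * cliquesIn G (suc k) (λ i → S i ∧ adj G (suc v) i)) ∎
  where
  open ≡-Reasoning
  G' = deleteFirst G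
  S⁺ = S ∘ suc
  s = 𝟙 (S zero)
  S₀ : Fin n → Bool
  S₀ i = S (suc i) ∧ adj G zero (suc i)
  regroup : ∀ k s x y → suc k * (s * x + y) ≡ s * x + (s * (k * x) + suc k * y)
  regroup = solve-∀
  shuffle : ∀ s t e c → s * ((t * e) * c) ≡ t * ((s * e) * c)
  shuffle = solve-∀
  ∧-swapʳ : ∀ a b c → (a ∧ b) ∧ c ≡ (a ∧ c) ∧ b
  ∧-swapʳ a b c = trans (∧-assoc a b c) (trans (cong (a ∧_) (∧-comm b c)) (sym (∧-assoc a c b)))
  -- Here the first vertex lies in the clique and another one is distinguished. Removing the first
  -- vertex leaves a clique in its neighbourhood, to which the induction hypothesis applies.
  through-first : s * (suc k * cliquesIn G' (suc k) S₀) ≡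
    sum λ v → 𝟙 (S⁺ v) * (𝟙 (S zero ∧ adj G (suc v) zero) *
      cliquesIn G' k (λ i → (S⁺ i ∧ adj G' v i) ∧ adj G zero (suc i)))
  through-first = begin
    s * (suc k * cliquesIn G' (suc k) S₀)
      ≡⟨ cong (s *_) (*-cliquesIn G' k S₀) ⟩
    s * sum (λ v → 𝟙 (S₀ v) * cliquesIn G' k (λ i → S₀ i ∧ adj G' v i))
      ≡⟨ *-distribˡ-sum {n} s _ ⟩
    sum (λ v → s * (𝟙 (S₀ v) * cliquesIn G' k (λ i → S₀ i ∧ adj G' v i)))
      ≡⟨ sum-cong-≗ (λ v → trans
           (cong₂ (λ e c → s * (e * c))
             (trans (𝟙-∧ (S⁺ v) _) (cong (λ b → 𝟙 (S⁺ v) * 𝟙 b) (Graph.sym G zero (suc v))))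
             (cliquesIn-cong G' k (λ i → ∧-swapʳ (S⁺ i) _ _)))
           (trans (shuffle s (𝟙 (S⁺ v)) _ _)
             (cong (λ e → 𝟙 (S⁺ v) * (e * cliquesIn G' k (λ i → (S⁺ i ∧ adj G' v i) ∧ adj G zero (suc i)))) (sym (𝟙-∧ (S zero) _))))) ⟩
    sum (λ v → 𝟙 (S⁺ v) * (𝟙 (S zero ∧ adj G (suc v) zero) *
      cliquesIn G' k (λ i → (S⁺ i ∧ adj G' v i) ∧ adj G zero (suc i)))) ∎

-- Counts tuples in `S` whose earlier entries are related to all later ones. No vertex is deleted
-- along the recursion, so these are plain sums over all vertices, which can be bounded term by term
-- and compared along embeddings.
orderedCliques : ∀ {n} → (Fin n → Fin n → Bool) → ℕ → (Fin n → Bool) → ℕ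
orderedCliques a zero S = 1
orderedCliques a (suc k) S = sum λ v → 𝟙 (S v) * orderedCliques a k (λ i → S i ∧ a v i)

!-*-cliquesIn : ∀ {n} (G : Graph n) k (S : Fin n → Bool) →
  k ! * cliquesIn G k S ≡ orderedCliques (adj G) k S
!-*-cliquesIn G zero S = refl
!-*-cliquesIn {n} G (suc k) S = begin
  (suc k * k !) * cliquesIn G (suc k) S
    ≡⟨ rotate (suc k) (k !) _ ⟩
  k ! * (suc k * cliquesIn G (suc k) S)
    ≡⟨ cong (k ! *_) (*-cliquesIn G k S) ⟩
  k ! * sum (λ v → 𝟙 (S v) * cliquesIn G k (λ i → S i ∧ adj G v i))
    ≡⟨ *-distribˡ-sum {n} (k !) _ ⟩
  sum (λ v → k ! * (𝟙 (S v) * cliquesIn G k (λ i → S i ∧ adj G v i)))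
    ≡⟨ sum-cong-≗ (λ v → trans (swap (k !) (𝟙 (S v)) _)
         (cong (𝟙 (S v) *_) (!-*-cliquesIn G k _))) ⟩
  sum (λ v → 𝟙 (S v) * orderedCliques (adj G) k (λ i → S i ∧ adj G v i)) ∎
  where
  open ≡-Reasoning
  rotate : ∀ a b c → (a * b) * c ≡ b * (a * c)
  rotate = solve-∀
  swap : ∀ a b c → a * (b * c) ≡ b * (a * c)
  swap = solve-∀

everywhere : ∀ {n} → Fin n → Bool
everywhere _ = true

!-*-copiesK : ∀ {n} k (G : Graph n) → k ! * copiesK k G ≡ orderedCliques (adj G) k everywhere
!-*-copiesK k G = trans (cong (k ! *_) (copiesK-cliquesIn k G)) (!-*-cliquesIn G k everywhere)

copiesK≡0⇒ordered≡0 : ∀ {n} k (G : Graph n) →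
  copiesK k G ≡ 0 → orderedCliques (adj G) k everywhere ≡ 0
copiesK≡0⇒ordered≡0 k G eq = trans (sym (!-*-copiesK k G)) (trans (cong (k ! *_) eq) (*-zeroʳ (k !)))

ordered≡0⇒copiesK≡0 : ∀ {n} k (G : Graph n) →
  orderedCliques (adj G) k everywhere ≡ 0 → copiesK k G ≡ 0
ordered≡0⇒copiesK≡0 k G eq with m*n≡0⇒m≡0∨n≡0 (k !) (trans (!-*-copiesK k G) eq)
... | inj₁ k!≡0 = contradiction k!≡0 (≢-nonZero⁻¹ (k !) {{k !≢0}})
... | inj₂ c≡0 = c≡0

-- Joining independent sets

∑-↑ˡ-≤ : ∀ m {n} (f : Fin (m + n) → ℕ) → sum (f ∘ (_↑ˡ n)) ≤ sum f
∑-↑ˡ-≤ m f = ≤-trans (m≤m+n _ _) (≤-reflexive (sym (∑-↑ m f)))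

∑-↑ʳ-≤ : ∀ m {n} (f : Fin (m + n) → ℕ) → sum (f ∘ (m ↑ʳ_)) ≤ sum f
∑-↑ʳ-≤ m f = ≤-trans (m≤n+m _ _) (≤-reflexive (sym (∑-↑ m f)))

-- The witness is the better of `zero` and the index found in the tail. Multiplying by `suc m`
-- replaces dividing by the number of terms.
∃-below-average : ∀ {m} (f : Fin (suc m) → ℕ) → ∃[ u ] suc m * f u ≤ sum f
∃-below-average {zero} f = zero , ≤-refl
∃-below-average {suc m} f with ∃-below-average (f ∘ suc)
... | u , avg with f zero ≤? f (suc u)
...   | yes f0≤ = zero , +-monoʳ-≤ (f zero) (≤-trans (*-monoʳ-≤ (suc m) f0≤) avg)
...   | no f0≰ = suc u , +-mono-≤ (≰⇒≥ f0≰) avg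

-- A deleted edge is counted in both orders. As a double sum this avoids truncated subtraction and
-- can be restricted to parts of the vertex set; `2*deletedEdges` relates it to the number of edges.
deletedPairs : ∀ {n} → Graph n → Graph n → ℕ
deletedPairs G G' = sum λ i → sum λ j → 𝟙 (adj G i j ∧ not (adj G' i j))

addVertex : ∀ {n} → (Fin n → Bool) → Graph n → Graph (suc n)
addVertex {n} S G = record { adj = a ; sym = a-sym ; irrefl = a-irrefl }
  where
  a : Fin (suc n) → Fin (suc n) → Bool
  a zero zero = false
  a zero (suc j) = S j
  a (suc i) zero = S i
  a (suc i) (suc j) = adj G i j
  a-sym : ∀ i j → a i j ≡ a j i
  a-sym zero zero = refl
  a-sym zero (suc j) = refl
  a-sym (suc i) zero = refl
  a-sym (suc i) (suc j) = Graph.sym G i j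
  a-irrefl : ∀ i → a i i ≡ false
  a-irrefl zero = refl
  a-irrefl (suc i) = irrefl G i

isOld : ∀ M {n} → Fin (M + n) → Bool
isOld zero i = true
isOld (suc M) zero = false
isOld (suc M) (suc i) = isOld M i

-- The new vertices stand in front and see only old ones, so they form an independent set. Since
-- `cliquesIn` also recurses on the first vertex, clique counts unfold along the same recursion.
joinIndependent : ∀ M {n} → Graph n → Graph (M + n)
joinIndependent zero G = G
joinIndependent (suc M) G = addVertex (isOld M) (joinIndependent M G)

isOld-↑ʳ : ∀ M {n} (i : Fin n) → isOld M (M ↑ʳ i) ≡ true
isOld-↑ʳ zero i = refl
isOld-↑ʳ (suc M) i = isOld-↑ʳ M i

join-new-old : ∀ M {n} (G : Graph n) u v → adj (joinIndependent M G) (u ↑ˡ n) (M ↑ʳ v) ≡ true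
join-new-old (suc M) G zero v = isOld-↑ʳ M v
join-new-old (suc M) G (suc u) v = join-new-old M G u v

join-old-old : ∀ M {n} (G : Graph n) i j → adj (joinIndependent M G) (M ↑ʳ i) (M ↑ʳ j) ≡ adj G i j
join-old-old zero G i j = refl
join-old-old (suc M) G i j = join-old-old M G i j

cliquesIn-isOld : ∀ M {n} (G : Graph n) k →
  cliquesIn (joinIndependent M G) k (isOld M) ≡ cliquesIn G k everywhere
cliquesIn-isOld zero G k = refl
cliquesIn-isOld (suc M) G zero = refl
cliquesIn-isOld (suc M) G (suc k) = cliquesIn-isOld M G (suc k)

-- A clique contains at most one vertex of the independent set, and then all its other vertices lie
-- in `G`.
cliquesIn-join : ∀ M {n} (G : Graph n) k →
  cliquesIn (joinIndependent M G) (suc k) everywhere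
  ≡ M * cliquesIn G k everywhere + cliquesIn G (suc k) everywhere
cliquesIn-join zero G k = refl
cliquesIn-join (suc M) G k = trans
  (cong₂ _+_ (trans (*-identityˡ _) (cliquesIn-isOld M G k)) (cliquesIn-join M G k))
  (sym (+-assoc (cliquesIn G k everywhere) _ _))

copiesK-join : ∀ M {n} (G : Graph n) k →
  copiesK (suc k) (joinIndependent M G) ≡ M * copiesK k G + copiesK (suc k) G
copiesK-join M G k
  rewrite copiesK-cliquesIn (suc k) (joinIndependent M G) | copiesK-cliquesIn k G
        | copiesK-cliquesIn (suc k) G = cliquesIn-join M G k

-- A new vertex sees all `n` old ones, and an old vertex gains `M` neighbours; the two hypotheses
-- treat these cases.
deg-join : ∀ M {n} (G : Graph n) d → d ≤ n → (∀ v → d ≤ M + deg G v) →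
  ∀ x → d ≤ deg (joinIndependent M G) x
deg-join M {n} G d d≤n d≤deg x = subst (d ≤_) (sym (deg-∑ J x)) bound
  where
  J = joinIndependent M G
  open ≤-Reasoning
  bound : d ≤ sum (𝟙 ∘ adj J x)
  bound with splitAt M x in eq
  ... | inj₁ u = begin
    d                                ≤⟨ d≤n ⟩
    n                                ≡⟨ *-identityʳ n ⟨
    n * 1                            ≡⟨ ∑-const n 1 ⟨
    sum {n} (λ _ → 1)                ≡⟨ sum-cong-≗ (λ v → cong 𝟙 (sym (adj-x v))) ⟩
    sum (𝟙 ∘ adj J x ∘ (M ↑ʳ_))      ≤⟨ ∑-↑ʳ-≤ M _ ⟩
    sum (𝟙 ∘ adj J x)                ∎
    where
    adj-x : ∀ v → adj J x (M ↑ʳ v) ≡ true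
    adj-x v = trans (cong (λ y → adj J y (M ↑ʳ v)) (sym (splitAt⁻¹-↑ˡ eq))) (join-new-old M G u v)
  ... | inj₂ v = begin
    d                                                          ≤⟨ d≤deg v ⟩
    M + deg G v                                                ≡⟨ cong₂ _+_ (trans (sym (*-identityʳ M)) (sym (∑-const M 1))) (deg-∑ G v) ⟩
    sum {M} (λ _ → 1) + sum (𝟙 ∘ adj G v)                      ≡⟨ cong₂ _+_ (sum-cong-≗ (λ u → cong 𝟙 (sym (adj-new u)))) (sum-cong-≗ (λ j → cong 𝟙 (sym (adj-old j)))) ⟩
    sum (𝟙 ∘ adj J x ∘ (_↑ˡ n)) + sum (𝟙 ∘ adj J x ∘ (M ↑ʳ_))  ≡⟨ ∑-↑ M _ ⟨
    sum (𝟙 ∘ adj J x)                                          ∎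
    where
    adj-new : ∀ u → adj J x (u ↑ˡ n) ≡ true
    adj-new u = trans (cong (λ y → adj J y (u ↑ˡ n)) (sym (splitAt⁻¹-↑ʳ eq)))
      (trans (Graph.sym J (M ↑ʳ v) (u ↑ˡ n)) (join-new-old M G u v))
    adj-old : ∀ j → adj J x (M ↑ʳ j) ≡ adj G v j
    adj-old j = trans (cong (λ y → adj J y (M ↑ʳ j)) (sym (splitAt⁻¹-↑ʳ eq))) (join-old-old M G v j)

T-∧⁺ : ∀ {b c} → T b → T c → T (b ∧ c)
T-∧⁺ {true} {true} _ _ = tt

T-∧ˡ : ∀ {b c} → T (b ∧ c) → T b
T-∧ˡ {true} _ = tt

T-∧ʳ : ∀ b {c} → T (b ∧ c) → T c
T-∧ʳ true h = h

orderedCliques-↑ʳ-≤ : ∀ M {n} {a : Fin n → Fin n → Bool} {a' : Fin (M + n) → Fin (M + n) → Bool} →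
  (∀ i j → T (a i j) → T (a' (M ↑ʳ i) (M ↑ʳ j))) →
  ∀ k {S S'} → (∀ i → T (S i) → T (S' (M ↑ʳ i))) → orderedCliques a k S ≤ orderedCliques a' k S'
orderedCliques-↑ʳ-≤ M a≤a' zero S≤S' = ≤-refl
orderedCliques-↑ʳ-≤ M {n} {a} {a'} a≤a' (suc k) {S} {S'} S≤S' =
  ≤-trans
    (∑-mono λ v → *-mono-≤ (𝟙-mono (S≤S' v)) (orderedCliques-↑ʳ-≤ M a≤a' k
      (λ i h → T-∧⁺ (S≤S' i (T-∧ˡ h)) (a≤a' v i (T-∧ʳ (S i) h)))))
    (∑-↑ʳ-≤ M (λ x → 𝟙 (S' x) * orderedCliques a' k (λ y → S' y ∧ a' x y)))

orderedCliques-∅ : ∀ {n} (a : Fin n → Fin n → Bool) k {S} → (∀ i → S i ≡ false) →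
  orderedCliques a (suc k) S ≡ 0
orderedCliques-∅ {n} a k {S} S≡∅ = ∑-zero {n} λ v →
  cong (λ b → 𝟙 b * orderedCliques a k (λ i → S i ∧ a v i)) (S≡∅ v)

-- Keep the edges of J' inside the J'-neighbourhood of the new vertex u that lost the fewest edges.
K-free-descent : ∀ M {n} (G : Graph n) k (J' : Graph (suc M + n)) →
  J' ⊆G joinIndependent (suc M) G → copiesK (3 + k) J' ≡ 0 →
  Σ (Graph n) λ G' → (G' ⊆G G) × (copiesK (2 + k) G' ≡ 0) ×
    (suc M * deletedPairs G G' ≤ (suc M + 2 * n) * deletedPairs (joinIndependent (suc M) G) J')
K-free-descent M {n} G k J' J'⊆J J'-free = G' , G'⊆G , G'-free , few-deleted
  where
  J = joinIndependent (suc M) G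
  new : Fin (suc M) → Fin (suc M + n)
  new u = u ↑ˡ n
  old : Fin n → Fin (suc M + n)
  old i = suc M ↑ʳ i
  lost : Fin (suc M) → ℕ
  lost u = sum λ v → 𝟙 (not (adj J' (new u) (old v)))
  u = proj₁ (∃-below-average lost)
  S : Fin n → Bool
  S i = adj J' (new u) (old i)
  G' : Graph n
  G' = record
    { adj = λ i j → (S i ∧ S j) ∧ adj J' (old i) (old j)
    ; sym = λ i j → cong₂ _∧_ (∧-comm (S i) (S j)) (Graph.sym J' (old i) (old j))
    ; irrefl = λ i → trans (cong ((S i ∧ S i) ∧_) (irrefl J' (old i))) (∧-zeroʳ _) }
  G'⊆G : G' ⊆G G
  G'⊆G i j h = subst T (join-old-old (suc M) G i j) (J'⊆J (old i) (old j) (T-∧ʳ (S i ∧ S j) h))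
  D = deletedPairs J J'

  -- A clique in the neighbourhood of `new u` extends by `new u`. In the vanishing sum for `J'`,
  -- this count is the term at `new u`.
  nbhd-free : orderedCliques (adj J') (2 + k) (adj J' (new u)) ≡ 0
  nbhd-free = trans (sym (*-identityˡ _))
    (∑-≡0⁻ (λ x → 1 * orderedCliques (adj J') (2 + k) (adj J' x))
      (copiesK≡0⇒ordered≡0 (3 + k) J' J'-free) (new u))
  G'-free : copiesK (2 + k) G' ≡ 0
  G'-free = ordered≡0⇒copiesK≡0 (2 + k) G' (n≤0⇒n≡0 (begin
    orderedCliques (adj G') (2 + k) everywhere
      ≤⟨ ∑-mono at ⟩
    sum (λ i → 𝟙 (S i) * orderedCliques (adj J') (1 + k) (λ y → adj J' (new u) y ∧ adj J' (old i) y))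
      ≤⟨ ∑-↑ʳ-≤ (suc M) (λ x → 𝟙 (adj J' (new u) x) *
           orderedCliques (adj J') (1 + k) (λ y → adj J' (new u) y ∧ adj J' x y)) ⟩
    orderedCliques (adj J') (2 + k) (adj J' (new u))
      ≡⟨ nbhd-free ⟩
    0 ∎))
    where
    open ≤-Reasoning
    at : ∀ i → 1 * orderedCliques (adj G') (1 + k) (adj G' i) ≤
      𝟙 (S i) * orderedCliques (adj J') (1 + k) (λ y → adj J' (new u) y ∧ adj J' (old i) y)
    at i with S i in eq
    ... | true = *-monoʳ-≤ 1 (orderedCliques-↑ʳ-≤ (suc M) {a = adj G'} {adj J'}
      (λ p q → T-∧ʳ (S p ∧ S q)) (1 + k)
      {S' = λ y → adj J' (new u) y ∧ adj J' (old i) y} (λ j h → h))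
    ... | false = ≤-reflexive (trans (*-identityˡ _) (orderedCliques-∅ (adj G') k
      (λ j → refl)))

  -- A pair of `G` is absent from `G'` only if one endpoint is outside `S` or the pair itself was
  -- deleted in `J'`.
  pointwise : ∀ g s t e → 𝟙 (g ∧ not ((s ∧ t) ∧ e)) ≤ 𝟙 (not s) + (𝟙 (not t) + 𝟙 (g ∧ not e))
  pointwise false s t e = z≤n
  pointwise true false t e = s≤s z≤n
  pointwise true true false e = s≤s z≤n
  pointwise true true true e = ≤-refl

  lost-total : sum lost ≤ D
  lost-total = begin
    sum lost
      ≡⟨ sum-cong-≗ (λ v → sum-cong-≗ (λ w →
           cong (λ b → 𝟙 (b ∧ not (adj J' (new v) (old w)))) (sym (join-new-old (suc M) G v w)))) ⟩
    sum (λ v → sum λ w → 𝟙 (adj J (new v) (old w) ∧ not (adj J' (new v) (old w))))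
      ≤⟨ ∑-mono (λ v → ∑-↑ʳ-≤ (suc M) (λ y → 𝟙 (adj J (new v) y ∧ not (adj J' (new v) y)))) ⟩
    sum (λ v → sum λ y → 𝟙 (adj J (new v) y ∧ not (adj J' (new v) y)))
      ≤⟨ ∑-↑ˡ-≤ (suc M) (λ x → sum λ y → 𝟙 (adj J x y ∧ not (adj J' x y))) ⟩
    D ∎
    where open ≤-Reasoning

  old-deleted : sum (λ i → sum λ j → 𝟙 (adj G i j ∧ not (adj J' (old i) (old j)))) ≤ D
  old-deleted = begin
    sum (λ i → sum λ j → 𝟙 (adj G i j ∧ not (adj J' (old i) (old j))))
      ≡⟨ sum-cong-≗ (λ i → sum-cong-≗ (λ j →
           cong (λ b → 𝟙 (b ∧ not (adj J' (old i) (old j)))) (sym (join-old-old (suc M) G i j)))) ⟩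
    sum (λ i → sum λ j → 𝟙 (adj J (old i) (old j) ∧ not (adj J' (old i) (old j))))
      ≤⟨ ∑-mono (λ i → ∑-↑ʳ-≤ (suc M) (λ y → 𝟙 (adj J (old i) y ∧ not (adj J' (old i) y)))) ⟩
    sum (λ i → sum λ y → 𝟙 (adj J (old i) y ∧ not (adj J' (old i) y)))
      ≤⟨ ∑-↑ʳ-≤ (suc M) (λ x → sum λ y → 𝟙 (adj J x y ∧ not (adj J' x y))) ⟩
    D ∎
    where open ≤-Reasoning

  -- There are `lost u` vertices outside `S`; each spoils at most `n` pairs as first entry and `n`
  -- as second entry.
  deleted-≤ : deletedPairs G G' ≤ 2 * n * lost u + D
  deleted-≤ = begin
    deletedPairs G G'
      ≤⟨ ∑-mono (λ i → ∑-mono (λ j → pointwise (adj G i j) (S i) (S j) (adj J' (old i) (old j)))) ⟩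
    sum (λ i → sum λ j → 𝟙 (not (S i)) + (𝟙 (not (S j)) + e i j))
      ≡⟨ sum-cong-≗ (λ i → trans (∑-distrib-+ {n} _ _)
           (cong₂ _+_ (∑-const n (𝟙 (not (S i)))) (∑-distrib-+ {n} _ _))) ⟩
    sum (λ i → n * 𝟙 (not (S i)) + (lost u + sum (e i)))
      ≡⟨ trans (∑-distrib-+ {n} _ _) (cong₂ _+_ (sym (*-distribˡ-sum {n} n _))
           (trans (∑-distrib-+ {n} _ _) (cong (_+ sum (λ i → sum (e i))) (∑-const n (lost u))))) ⟩
    n * lost u + (n * lost u + sum (λ i → sum (e i)))
      ≤⟨ +-monoʳ-≤ (n * lost u) (+-monoʳ-≤ (n * lost u) old-deleted) ⟩
    n * lost u + (n * lost u + D)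
      ≡⟨ double n (lost u) D ⟩
    2 * n * lost u + D ∎
    where
    open ≤-Reasoning
    e : Fin n → Fin n → ℕ
    e i j = 𝟙 (adj G i j ∧ not (adj J' (old i) (old j)))
    double : ∀ n l d → n * l + (n * l + d) ≡ 2 * n * l + d
    double = solve-∀

  -- By the choice of `u`, `suc M * lost u` is at most the total loss between new and old vertices,
  -- hence at most `D`.
  few-deleted : suc M * deletedPairs G G' ≤ (suc M + 2 * n) * D
  few-deleted = begin
    suc M * deletedPairs G G'              ≤⟨ *-monoʳ-≤ (suc M) deleted-≤ ⟩
    suc M * (2 * n * lost u + D)           ≡⟨ regroup (suc M) n (lost u) D ⟩
    2 * n * (suc M * lost u) + suc M * D   ≤⟨ +-monoˡ-≤ (suc M * D) (*-monoʳ-≤ (2 * n)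
                                                (≤-trans (proj₂ (∃-below-average lost)) lost-total)) ⟩
    2 * n * D + suc M * D                  ≡⟨ collect (suc M) n D ⟩
    (suc M + 2 * n) * D                    ∎
    where
    open ≤-Reasoning
    regroup : ∀ m n l d → m * (2 * n * l + d) ≡ 2 * n * (m * l) + m * d
    regroup = solve-∀
    collect : ∀ m n d → 2 * n * d + m * d ≡ (m + 2 * n) * d
    collect = solve-∀

-- Iterated joins with independent sets

towerSize : ℕ → ℕ → ℕ → ℕ
towerSize M N zero = N
towerSize M N (suc s) = M + towerSize M N s

towerSize-≡ : ∀ M N s → towerSize M N s ≡ s * M + N
towerSize-≡ M N zero = refl
towerSize-≡ M N (suc s) = trans (cong (M +_) (towerSize-≡ M N s)) (sym (+-assoc M (s * M) N))

tower : ∀ M {N} → Graph N → ∀ s → Graph (towerSize M N s)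
tower M B zero = B
tower M B (suc s) = joinIndependent M (tower M B s)

module _ {N} (B : Graph N) (B-K₄-free : ∀ j → copiesK (4 + j) B ≡ 0) where

  -- Each join raises the clique number by at most one. The statement covers all larger cliques
  -- through `j` because the recursion for joins also refers to cliques of the same size one level
  -- below, which is the case `suc j` there.
  tower-clique-free : ∀ M s j → copiesK (4 + s + j) (tower M B s) ≡ 0
  tower-clique-free M zero j = B-K₄-free j
  tower-clique-free M (suc s) j = begin
    copiesK (5 + s + j) (joinIndependent M (tower M B s))
      ≡⟨ copiesK-join M (tower M B s) (4 + s + j) ⟩
    M * copiesK (4 + s + j) (tower M B s) + copiesK (5 + s + j) (tower M B s)
      ≡⟨ cong₂ (λ c d → M * c + d) (tower-clique-free M s j)
           (trans (cong (λ k → copiesK k (tower M B s)) (sym (+-suc (4 + s) j)))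
             (tower-clique-free M s (suc j))) ⟩
    M * 0 + 0
      ≡⟨ trans (+-identityʳ _) (*-zeroʳ M) ⟩
    0 ∎
    where open ≡-Reasoning

  -- Cliques that avoid the newest set are too large for the previous level, so every clique uses
  -- one vertex of the set and each join multiplies the count by `M`.
  copiesK-tower : ∀ M s → copiesK (3 + s) (tower M B s) ≡ M ^ s * copiesK 3 B
  copiesK-tower M zero = sym (*-identityˡ _)
  copiesK-tower M (suc s) = begin
    copiesK (4 + s) (tower M B (suc s))
      ≡⟨ copiesK-join M (tower M B s) (3 + s) ⟩
    M * copiesK (3 + s) (tower M B s) + copiesK (4 + s) (tower M B s)
      ≡⟨ cong₂ (λ c d → M * c + d) (copiesK-tower M s)
           (trans (cong (λ k → copiesK k (tower M B s)) (sym (+-identityʳ (4 + s))))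
             (tower-clique-free M s 0)) ⟩
    M * (M ^ s * copiesK 3 B) + 0
      ≡⟨ trans (+-identityʳ _) (sym (*-assoc M (M ^ s) _)) ⟩
    M ^ suc s * copiesK 3 B ∎
    where open ≡-Reasoning

-- A vertex of a joined set misses the `M` vertices of its own set; `w + M ≤ N` ensures that the
-- vertices below still give it the required degree.
deg-tower : ∀ M {N} (B : Graph N) w → w + M ≤ N → (∀ v → w ≤ deg B v) →
  ∀ s v → s * M + w ≤ deg (tower M B s) v
deg-tower M B w w+M≤N w≤deg zero = w≤deg
deg-tower M {N} B w w+M≤N w≤deg (suc s) = deg-join M (tower M B s) (suc s * M + w)
  (begin
    suc s * M + w      ≡⟨ regroup M (s * M) w ⟩
    s * M + (w + M)    ≤⟨ +-monoʳ-≤ (s * M) w+M≤N ⟩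
    s * M + N          ≡⟨ towerSize-≡ M N s ⟨
    towerSize M N s    ∎)
  (λ v → ≤-trans (≤-reflexive (+-assoc M (s * M) w)) (+-monoʳ-≤ M (deg-tower M B w w+M≤N w≤deg s v)))
  where
  open ≤-Reasoning
  regroup : ∀ m x w → (m + x) + w ≡ x + (w + m)
  regroup = solve-∀

-- Joining a set of size `m` to `n ≤ (s + 3) * m` vertices costs a factor `(m + 2 * n) / m` in
-- `K-free-descent`, which is at most `1 + 2 * (s + 3) = 7 + 2 * s`.
towerLoss : ℕ → ℕ
towerLoss zero = 1
towerLoss (suc s) = towerLoss s * (7 + 2 * s)

-- Peels off the joined sets, newest first. The bound on `N` keeps every level of the tower within a
-- constant multiple of the set size, so the loss does not depend on `M`.
tower-descent : ∀ M {N} (B : Graph N) → N ≤ 3 * suc M →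
  ∀ s (J : Graph (towerSize (suc M) N s)) → J ⊆G tower (suc M) B s → copiesK (3 + s) J ≡ 0 →
  Σ (Graph N) λ B' → (B' ⊆G B) × (copiesK 3 B' ≡ 0) ×
    (deletedPairs B B' ≤ towerLoss s * deletedPairs (tower (suc M) B s) J)
tower-descent M B N≤ zero J J⊆ J-free = J , J⊆ , J-free , ≤-reflexive (sym (*-identityˡ _))
tower-descent M {N} B N≤ (suc s) J J⊆ J-free =
  let G' , G'⊆ , G'-free , lossG' = K-free-descent M (tower (suc M) B s) (suc s) J J⊆ J-free
      B' , B'⊆ , B'-free , lossB' = tower-descent M B N≤ s G' G'⊆ G'-free
  in B' , B'⊆ , B'-free , (begin
  deletedPairs B B'
    ≤⟨ lossB' ⟩
  towerLoss s * deletedPairs (tower (suc M) B s) G'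
    ≤⟨ *-monoʳ-≤ (towerLoss s) (*-cancelˡ-≤ (suc M) (≤-trans lossG' (begin
         (suc M + 2 * n) * D               ≤⟨ *-monoˡ-≤ D (+-monoʳ-≤ (suc M) (*-monoʳ-≤ 2 n≤)) ⟩
         (suc M + 2 * ((s + 3) * suc M)) * D ≡⟨ regroup (suc M) s D ⟩
         suc M * ((7 + 2 * s) * D)         ∎))) ⟩
  towerLoss s * ((7 + 2 * s) * D)
    ≡⟨ *-assoc (towerLoss s) (7 + 2 * s) D ⟨
  towerLoss (suc s) * D ∎)
  where
  open ≤-Reasoning
  n = towerSize (suc M) N s
  D = deletedPairs (tower (suc M) B (suc s)) J
  n≤ : n ≤ (s + 3) * suc M
  n≤ = begin
    n                          ≡⟨ towerSize-≡ (suc M) N s ⟩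
    s * suc M + N              ≤⟨ +-monoʳ-≤ (s * suc M) N≤ ⟩
    s * suc M + 3 * suc M      ≡⟨ *-distribʳ-+ (suc M) s 3 ⟨
    (s + 3) * suc M            ∎
  regroup : ∀ m s d → (m + 2 * ((s + 3) * m)) * d ≡ m * ((7 + 2 * s) * d)
  regroup = solve-∀

-- The three-fold blow-up

¬T⇒triple≡0 : ∀ a b c → (T a → T b → T c → ⊥) → 𝟙 (true ∧ a) * (𝟙 ((true ∧ b) ∧ c) * 1) ≡ 0
¬T⇒triple≡0 true true true h = ⊥-elim (h tt tt tt)
¬T⇒triple≡0 true true false h = refl
¬T⇒triple≡0 true false c h = refl
¬T⇒triple≡0 false b c h = refl

TriangleFree : ∀ {n} → (Fin n → Fin n → Bool) → Set
TriangleFree a = ∀ x y z → T (a x y) → T (a x z) → T (a y z) → ⊥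

ordered₃ : ∀ {n} (a : Fin n → Fin n → Bool) → orderedCliques a 3 everywhere ≡
  sum λ x → sum λ y → sum λ z → 𝟙 (true ∧ a x y) * (𝟙 ((true ∧ a x z) ∧ a y z) * 1)
ordered₃ {n} a = sum-cong-≗ λ x → trans (*-identityˡ _)
  (sum-cong-≗ λ y → *-distribˡ-sum {n} (𝟙 (true ∧ a x y)) _)

triangleFree⇒copiesK≡0 : ∀ {n} (G : Graph n) → TriangleFree (adj G) → copiesK 3 G ≡ 0
triangleFree⇒copiesK≡0 {n} G free = ordered≡0⇒copiesK≡0 3 G (trans (ordered₃ (adj G))
  (∑-zero {n} λ x → ∑-zero {n} λ y → ∑-zero {n} λ z →
    ¬T⇒triple≡0 (adj G x y) (adj G x z) (adj G y z) (free x y z)))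

copiesK≡0⇒triangleFree : ∀ {n} (G : Graph n) → copiesK 3 G ≡ 0 → TriangleFree (adj G)
copiesK≡0⇒triangleFree G G-free x y z xy xz yz = nonzero xy xz yz
  (∑-≡0⁻ (λ z → t x y z) (∑-≡0⁻ (λ y → sum (t x y)) (∑-≡0⁻ (λ x → sum λ y → sum (t x y))
    (trans (sym (ordered₃ (adj G))) (copiesK≡0⇒ordered≡0 3 G G-free)) x) y) z)
  where
  t = λ x y z → 𝟙 (true ∧ adj G x y) * (𝟙 ((true ∧ adj G x z) ∧ adj G y z) * 1)
  nonzero : ∀ {a b c} → T a → T b → T c → 𝟙 (true ∧ a) * (𝟙 ((true ∧ b) ∧ c) * 1) ≢ 0
  nonzero {true} {true} {true} _ _ _ ()

-- A larger clique starts with four pairwise adjacent vertices, so the nested sum vanishes once its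
-- four outermost variables are expanded.
no-K₄⇒copiesK≡0 : ∀ {n} (G : Graph n) →
  (∀ x y z u → T (adj G x y) → T (adj G x z) → T (adj G y z) →
    T (adj G x u) → T (adj G y u) → T (adj G z u) → ⊥) →
  ∀ j → copiesK (4 + j) G ≡ 0
no-K₄⇒copiesK≡0 {n} G noK₄ j = ordered≡0⇒copiesK≡0 (4 + j) G
  (∑-zero {n} λ x → trans (*-identityˡ _) (∑-zero {n} λ y →
    vanish (true ∧ a x y) λ xy → ∑-zero {n} λ z →
    vanish ((true ∧ a x z) ∧ a y z) λ xyz → ∑-zero {n} λ u →
    vanish (((true ∧ a x u) ∧ a y u) ∧ a z u) λ xyzu →
      ⊥-elim (noK₄ x y z u xy (T-∧ˡ xyz) (T-∧ʳ (a x z) xyz)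
        (T-∧ˡ (T-∧ˡ xyzu)) (T-∧ʳ (a x u) (T-∧ˡ xyzu)) (T-∧ʳ (a x u ∧ a y u) xyzu))))
  where
  a = adj G
  vanish : ∀ b {m} → (T b → m ≡ 0) → 𝟙 b * m ≡ 0
  vanish true h = trans (*-identityˡ _) (h tt)
  vanish false h = refl

term-≤-∑ : ∀ {n} (f : Fin n → ℕ) i → f i ≤ sum f
term-≤-∑ f zero = m≤m+n _ _
term-≤-∑ f (suc i) = ≤-trans (term-≤-∑ (f ∘ suc) i) (m≤n+m _ _)

_==_ : ∀ {m} → Fin m → Fin m → Bool
p == q = toℕ p ≡ᵇ toℕ q

==⇒≡ : ∀ {m} {p q : Fin m} → T (p == q) → p ≡ q
==⇒≡ h = toℕ-injective (≡ᵇ⇒≡ _ _ h)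

==-refl : ∀ {m} (p : Fin m) → (p == p) ≡ true
==-refl zero = refl
==-refl (suc p) = ==-refl p

==-sym : ∀ {m} (p q : Fin m) → (p == q) ≡ (q == p)
==-sym zero zero = refl
==-sym zero (suc q) = refl
==-sym (suc p) zero = refl
==-sym (suc p) (suc q) = ==-sym p q

isZero : Fin 3 → Bool
isZero p = toℕ p ≡ᵇ 0

module Blowup {n} (G : Graph n) (w : ℕ) where

  -- Three copies of the vertices of G, each copy p with w extra vertices (p, inj₂ j)
  -- that see the whole copy and supply the minimum degree.
  V : Set
  V = Fin 3 × (Fin n ⊎ Fin w)

  -- The exclusive or makes the extra vertices complete bipartite, with those of copy 0 on one side
  -- and those of copies 1 and 2 on the other. No edge of `G` is placed inside a copy.
  _~_ : V → V → Bool
  (p , inj₁ i) ~ (q , inj₁ j) = not (p == q) ∧ adj G i j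
  (p , inj₁ i) ~ (q , inj₂ j) = p == q
  (p , inj₂ i) ~ (q , inj₁ j) = p == q
  (p , inj₂ i) ~ (q , inj₂ j) = isZero p xor isZero q

  ~-sym : ∀ X Y → (X ~ Y) ≡ (Y ~ X)
  ~-sym (p , inj₁ i) (q , inj₁ j) = cong₂ (λ b c → not b ∧ c) (==-sym p q) (Graph.sym G i j)
  ~-sym (p , inj₁ i) (q , inj₂ j) = ==-sym p q
  ~-sym (p , inj₂ i) (q , inj₁ j) = ==-sym p q
  ~-sym (p , inj₂ i) (q , inj₂ j) = xor-comm (isZero p) (isZero q)

  ~-irrefl : ∀ X → (X ~ X) ≡ false
  ~-irrefl (p , inj₁ i) = trans (cong (not (p == p) ∧_) (irrefl G i)) (∧-zeroʳ _)
  ~-irrefl (p , inj₂ i) = xor-same (isZero p)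

  N : ℕ
  N = 3 * (n + w)

  decode : Fin N → V
  decode x = proj₁ (remQuot {3} (n + w) x) , splitAt n (proj₂ (remQuot {3} (n + w) x))

  encode : V → Fin N
  encode (p , inj₁ i) = combine p (i ↑ˡ w)
  encode (p , inj₂ j) = combine p (n ↑ʳ j)

  decode-encode : ∀ X → decode (encode X) ≡ X
  decode-encode (p , inj₁ i) = trans
    (cong (λ r → proj₁ r , splitAt n (proj₂ r)) (remQuot-combine {3} p (i ↑ˡ w)))
    (cong (p ,_) (splitAt-↑ˡ n i w))
  decode-encode (p , inj₂ j) = trans
    (cong (λ r → proj₁ r , splitAt n (proj₂ r)) (remQuot-combine {3} p (n ↑ʳ j)))
    (cong (p ,_) (splitAt-↑ʳ n w j))

  B : Graph N
  B = record
    { adj = λ x y → decode x ~ decode y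
    ; sym = λ x y → ~-sym (decode x) (decode y)
    ; irrefl = λ x → ~-irrefl (decode x) }

  adj-encode : ∀ X Y → adj B (encode X) (encode Y) ≡ (X ~ Y)
  adj-encode X Y = cong₂ _~_ (decode-encode X) (decode-encode Y)

  ∑-encode : ∀ (f : Fin N → ℕ) → sum f ≡
    sum λ p → sum (λ i → f (encode (p , inj₁ i))) + sum (λ j → f (encode (p , inj₂ j)))
  ∑-encode f = trans (∑-combine 3 {n + w} f) (sum-cong-≗ λ p → ∑-↑ n (λ x → f (combine {3} p x)))

  -- Projects the three copies onto `G`. It is applied once to each vertex of a triangle, where the
  -- terms at extra vertices vanish.
  ∑-decode-≤ : ∀ (f : V → ℕ) (g : Fin n → ℕ) → (∀ p i → f (p , inj₁ i) ≤ g i) →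
    (∀ p j → f (p , inj₂ j) ≡ 0) → sum (f ∘ decode) ≤ 3 * sum g
  ∑-decode-≤ f g f≤g f≡0 = begin
    sum (f ∘ decode)
      ≡⟨ ∑-encode (f ∘ decode) ⟩
    sum (λ p → sum (λ i → f (decode (encode (p , inj₁ i)))) + sum (λ j → f (decode (encode (p , inj₂ j)))))
      ≤⟨ ∑-mono (λ p → +-mono-≤
           (∑-mono (λ i → ≤-trans (≤-reflexive (cong f (decode-encode (p , inj₁ i)))) (f≤g p i)))
           (≤-reflexive (∑-zero {w} λ j → trans (cong f (decode-encode (p , inj₂ j))) (f≡0 p j)))) ⟩
    sum {3} (λ p → sum g + 0)
      ≡⟨ trans (∑-const 3 (sum g + 0)) (cong (3 *_) (+-identityʳ (sum g))) ⟩
    3 * sum g ∎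
    where open ≤-Reasoning

  -- The neighbours of an extra vertex of copy `p` are copy `p` itself, which is independent, and
  -- extra vertices across the bipartition. The latter are pairwise nonadjacent and see no vertex of
  -- copy `p`.
  extra-in-no-triangle : ∀ p j Y Z →
    T ((p , inj₂ j) ~ Y) → T ((p , inj₂ j) ~ Z) → T (Y ~ Z) → ⊥
  extra-in-no-triangle p j (q , inj₁ _) (r , inj₁ _) XY XZ YZ
    with refl ← ==⇒≡ {p = p} {q} XY | refl ← ==⇒≡ {p = p} {r} XZ =
      subst (T ∘ not) (==-refl p) (T-∧ˡ YZ)
  extra-in-no-triangle p j (q , inj₁ _) (r , inj₂ _) XY XZ YZ
    with refl ← ==⇒≡ {p = p} {q} XY | refl ← ==⇒≡ {p = q} {r} YZ = subst T (xor-same (isZero p)) XZ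
  extra-in-no-triangle p j (q , inj₂ _) (r , inj₁ _) XY XZ YZ
    with refl ← ==⇒≡ {p = p} {r} XZ | refl ← ==⇒≡ {p = q} {r} YZ = subst T (xor-same (isZero p)) XY
  extra-in-no-triangle p j (q , inj₂ _) (r , inj₂ _) = bipartite (isZero p) (isZero q) (isZero r)
    where
    bipartite : ∀ a b c → T (a xor b) → T (a xor c) → T (b xor c) → ⊥
    bipartite false true true _ _ ()
    bipartite true false false _ _ ()

  ~-flip : ∀ X Y → T (X ~ Y) → T (Y ~ X)
  ~-flip X Y = subst T (~-sym X Y)

  -- No extra vertex can occur, so four adjacent vertices would lie in four distinct copies. That
  -- three indices do not suffice is decided by enumeration.
  ~-no-K₄ : ∀ X Y Z U → T (X ~ Y) → T (X ~ Z) → T (Y ~ Z) → T (X ~ U) → T (Y ~ U) → T (Z ~ U) → ⊥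
  ~-no-K₄ (p , inj₂ j) Y Z U XY XZ YZ XU YU ZU = extra-in-no-triangle p j Y Z XY XZ YZ
  ~-no-K₄ X@(_ , inj₁ _) Y@(q , inj₂ j) Z U XY XZ YZ XU YU ZU =
    extra-in-no-triangle q j X Z (~-flip X Y XY) YZ XZ
  ~-no-K₄ X@(_ , inj₁ _) Y@(_ , inj₁ _) Z@(r , inj₂ j) U XY XZ YZ XU YU ZU =
    extra-in-no-triangle r j X Y (~-flip X Z XZ) (~-flip Y Z YZ) XY
  ~-no-K₄ X@(_ , inj₁ _) Y@(_ , inj₁ _) Z@(_ , inj₁ _) U@(s , inj₂ j) XY XZ YZ XU YU ZU =
    extra-in-no-triangle s j X Y (~-flip X U XU) (~-flip Y U YU) XY
  ~-no-K₄ (p , inj₁ _) (q , inj₁ _) (r , inj₁ _) (s , inj₁ _) XY XZ YZ XU YU ZU =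
    subst T (not-distinct p q r s)
      (T-∧⁺ (T-∧⁺ (T-∧⁺ (T-∧ˡ {not (p == q)} XY) (T-∧ˡ {not (p == r)} XZ))
              (T-∧⁺ (T-∧ˡ {not (q == r)} YZ) (T-∧ˡ {not (p == s)} XU)))
        (T-∧⁺ (T-∧ˡ {not (q == s)} YU) (T-∧ˡ {not (r == s)} ZU)))
    where
    distinct : (p q r s : Fin 3) → Bool
    distinct p q r s = ((not (p == q) ∧ not (p == r)) ∧ (not (q == r) ∧ not (p == s)))
      ∧ (not (q == s) ∧ not (r == s))
    not-distinct : ∀ p q r s → distinct p q r s ≡ false
    not-distinct = toWitness {a? = all? λ p → all? λ q → all? λ r → all? λ s → distinct p q r s ≟ᵇ false} tt

  B-no-K₄ : ∀ j → copiesK (4 + j) B ≡ 0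
  B-no-K₄ = no-K₄⇒copiesK≡0 B λ x y z u → ~-no-K₄ (decode x) (decode y) (decode z) (decode u)

  private
    triple : Bool → Bool → Bool → ℕ
    triple a b c = 𝟙 (true ∧ a) * (𝟙 ((true ∧ b) ∧ c) * 1)

  -- There are at most `3 * 3 * 3` ways to place the vertices of an ordered triangle of `G` in
  -- copies. The factor 6 counts orderings on both sides.
  B-triangles : copiesK 3 B ≤ 27 * copiesK 3 G
  B-triangles = *-cancelˡ-≤ 6 (begin
    6 * copiesK 3 B
      ≡⟨ trans (!-*-copiesK 3 B) (ordered₃ (adj B)) ⟩
    sum ((λ X → sum λ y → sum λ z → tB X (decode y) (decode z)) ∘ decode)
      ≤⟨ ∑-decode-≤ (λ X → sum λ y → sum λ z → tB X (decode y) (decode z))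
           (λ i → 3 * sum λ j → 3 * sum (tG i j)) first
           (λ p j → ∑-zero {N} λ y → ∑-zero {N} λ z → tB-zero₁ p j (decode y) (decode z)) ⟩
    3 * sum (λ i → 3 * sum λ j → 3 * sum (tG i j))
      ≡⟨ cong (3 *_) (trans (sum-cong-≗ (λ i → cong (3 *_) (sym (*-distribˡ-sum {n} 3 (λ j → sum (tG i j))))))
           (trans (sym (*-distribˡ-sum {n} 3 (λ i → 3 * sum λ j → sum (tG i j))))
             (cong (3 *_) (sym (*-distribˡ-sum {n} 3 (λ i → sum λ j → sum (tG i j))))))) ⟩
    3 * (3 * (3 * sum (λ i → sum λ j → sum (tG i j))))
      ≡⟨ cong (λ t → 3 * (3 * (3 * t))) (trans (sym (ordered₃ (adj G))) (sym (!-*-copiesK 3 G))) ⟩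
    3 * (3 * (3 * (6 * copiesK 3 G)))
      ≡⟨ regroup (copiesK 3 G) ⟩
    6 * (27 * copiesK 3 G) ∎)
    where
    open ≤-Reasoning
    regroup : ∀ c → 3 * (3 * (3 * (6 * c))) ≡ 6 * (27 * c)
    regroup = solve-∀
    tB : V → V → V → ℕ
    tB X Y Z = triple (X ~ Y) (X ~ Z) (Y ~ Z)
    tG : Fin n → Fin n → Fin n → ℕ
    tG i j k = triple (adj G i j) (adj G i k) (adj G j k)
    triple-mono : ∀ a b c d e f → triple (d ∧ a) (e ∧ b) (f ∧ c) ≤ triple a b c
    triple-mono true true true true true true = ≤-refl
    triple-mono true true true true true false = z≤n
    triple-mono true true true true false f = z≤n
    triple-mono true true true false e f = z≤n
    triple-mono true true false true true true = z≤n
    triple-mono true true false true true false = z≤n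
    triple-mono true true false true false f = z≤n
    triple-mono true true false false e f = z≤n
    triple-mono true false c true true f = z≤n
    triple-mono true false c true false f = z≤n
    triple-mono true false c false e f = z≤n
    triple-mono false b c true e f = z≤n
    triple-mono false b c false e f = z≤n
    tB-zero₁ : ∀ p j Y Z → tB (p , inj₂ j) Y Z ≡ 0
    tB-zero₁ p j Y Z = ¬T⇒triple≡0 (X ~ Y) (X ~ Z) (Y ~ Z) (extra-in-no-triangle p j Y Z)
      where X = p , inj₂ j
    tB-zero₂ : ∀ X p j Z → tB X (p , inj₂ j) Z ≡ 0
    tB-zero₂ X p j Z = ¬T⇒triple≡0 (X ~ Y) (X ~ Z) (Y ~ Z)
      (λ XY XZ YZ → extra-in-no-triangle p j X Z (~-flip X Y XY) YZ XZ)
      where Y = p , inj₂ j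
    tB-zero₃ : ∀ X Y p j → tB X Y (p , inj₂ j) ≡ 0
    tB-zero₃ X Y p j = ¬T⇒triple≡0 (X ~ Y) (X ~ Z) (Y ~ Z)
      (λ XY XZ YZ → extra-in-no-triangle p j X Y (~-flip X Z XZ) (~-flip Y Z YZ) XY)
      where Z = p , inj₂ j
    third : ∀ p i q j → sum (tB (p , inj₁ i) (q , inj₁ j) ∘ decode) ≤ 3 * sum (tG i j)
    third p i q j = ∑-decode-≤ (tB (p , inj₁ i) (q , inj₁ j)) (tG i j)
      (λ r k → triple-mono (adj G i j) (adj G i k) (adj G j k) (not (p == q)) (not (p == r)) (not (q == r)))
      (tB-zero₃ (p , inj₁ i) (q , inj₁ j))
    first : ∀ p i → sum (λ y → sum λ z → tB (p , inj₁ i) (decode y) (decode z))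
      ≤ 3 * sum λ j → 3 * sum (tG i j)
    first p i = ∑-decode-≤ (λ Y → sum λ z → tB (p , inj₁ i) Y (decode z)) (λ j → 3 * sum (tG i j))
      (third p i) (λ q j → ∑-zero {N} λ z → tB-zero₂ (p , inj₁ i) q j (decode z))

  -- A vertex in a copy sees the `w` extra vertices of that copy. An extra vertex sees the `w` extra
  -- vertices of a copy across the bipartition, which `other` selects.
  B-deg : ∀ v → w ≤ deg B v
  B-deg v = begin
    w                                                    ≡⟨ trans (sym (*-identityʳ w)) (sym (∑-const w 1)) ⟩
    sum {w} (λ _ → 1)                                    ≡⟨ sum-cong-≗ (λ j → cong 𝟙 (sym (trans (cong (decode v ~_) (decode-encode (q , inj₂ j))) (adjacent (decode v) j)))) ⟩
    sum (λ j → f (encode (q , inj₂ j)))                  ≤⟨ m≤n+m _ _ ⟩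
    sum (λ i → f (encode (q , inj₁ i))) + sum (λ j → f (encode (q , inj₂ j)))
                                                         ≤⟨ term-≤-∑ (λ q → sum (λ i → f (encode (q , inj₁ i))) + sum (λ j → f (encode (q , inj₂ j)))) q ⟩
    sum (λ q → sum (λ i → f (encode (q , inj₁ i))) + sum (λ j → f (encode (q , inj₂ j))))
                                                         ≡⟨ trans (deg-∑ B v) (∑-encode f) ⟨
    deg B v                                              ∎
    where
    open ≤-Reasoning
    f : Fin N → ℕ
    f = 𝟙 ∘ adj B v
    other : Fin 3 → Fin 3
    other zero = suc zero
    other (suc _) = zero
    partner : V → Fin 3
    partner (p , inj₁ _) = p
    partner (p , inj₂ _) = other p
    q = partner (decode v)
    adjacent : ∀ X j → (X ~ (partner X , inj₂ j)) ≡ true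
    adjacent (p , inj₁ _) j = ==-refl p
    adjacent (zero , inj₂ _) j = refl
    adjacent (suc p , inj₂ _) j = refl

  module _ (B' : Graph N) (B'⊆B : B' ⊆G B) (B'-free : copiesK 3 B' ≡ 0) where
    private
      at : Fin 3 → Fin n → Fin N
      at p i = encode (p , inj₁ i)
      e : Fin 3 → Fin 3 → Fin n → Fin n → Bool
      e p q i j = adj B' (at p i) (at q j)
      e⇒G : ∀ p q i j → T (e p q i j) → T (adj G i j)
      e⇒G p q i j h = T-∧ʳ (not (p == q))
        (subst T (adj-encode (p , inj₁ i) (q , inj₁ j)) (B'⊆B _ _ h))
      both : Fin 3 → Fin 3 → Fin n → Fin n → Bool
      both p q i j = e p q i j ∧ e p q j i
      both-sym : ∀ p q i j → both p q i j ≡ both p q j i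
      both-sym p q i j = ∧-comm (e p q i j) (e p q j i)
      0F 1F 2F : Fin 3
      0F = zero
      1F = suc zero
      2F = suc (suc zero)
      -- All six edges of `B` over a pair must survive. Taking both orientations makes the relation
      -- symmetric.
      a : Fin n → Fin n → Bool
      a i j = both 0F 1F i j ∧ (both 0F 2F i j ∧ both 1F 2F i j)
      a⇒G : ∀ i j → T (a i j) → T (adj G i j)
      a⇒G i j h = e⇒G 0F 1F i j (T-∧ˡ (T-∧ˡ h))

    common : Graph n
    common = record
      { adj = a
      ; sym = λ i j → cong₂ _∧_ (both-sym 0F 1F i j) (cong₂ _∧_ (both-sym 0F 2F i j) (both-sym 1F 2F i j))
      ; irrefl = λ i → ¬T⇒false (λ h → subst T (irrefl G i) (a⇒G i i h)) }
      where
      ¬T⇒false : ∀ {b} → (T b → ⊥) → b ≡ false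
      ¬T⇒false {true} h = ⊥-elim (h tt)
      ¬T⇒false {false} h = refl

    common⊆G : common ⊆G G
    common⊆G = a⇒G

    -- A triangle would lift to `B'` with its vertices in copies 0, 1 and 2.
    common-free : copiesK 3 common ≡ 0
    common-free = triangleFree⇒copiesK≡0 common λ i j k ij ik jk →
      copiesK≡0⇒triangleFree B' B'-free (at 0F i) (at 1F j) (at 2F k)
        (T-∧ˡ (T-∧ˡ ij)) (T-∧ˡ (T-∧ˡ (T-∧ʳ (both 0F 1F i k) ik)))
        (T-∧ˡ (T-∧ʳ (both 0F 2F j k) (T-∧ʳ (both 0F 1F j k) jk)))

    private
      D = deletedPairs B B'
      missing : Fin 3 → Fin 3 → Fin n → Fin n → ℕ
      missing p q i j = 𝟙 (adj G i j ∧ not (e p q i j))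

      ∑-at-≤ : ∀ p (f : Fin N → ℕ) → sum (λ i → f (at p i)) ≤ sum f
      ∑-at-≤ p f = ≤-trans (m≤m+n _ _) (≤-trans
        (term-≤-∑ (λ p → sum (λ i → f (encode (p , inj₁ i))) + sum (λ j → f (encode (p , inj₂ j)))) p)
        (≤-reflexive (sym (∑-encode f))))

      missing-≤ : ∀ p q → T (not (p == q)) → sum (λ i → sum (missing p q i)) ≤ D
      missing-≤ p q p≠q = begin
        sum (λ i → sum (missing p q i))
          ≡⟨ sum-cong-≗ (λ i → sum-cong-≗ (λ j → cong (λ b → 𝟙 (b ∧ not (e p q i j)))
               (trans (G≡ i j) (sym (adj-encode (p , inj₁ i) (q , inj₁ j)))))) ⟩
        sum (λ i → sum λ j → 𝟙 (adj B (at p i) (at q j) ∧ not (adj B' (at p i) (at q j))))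
          ≤⟨ ∑-mono (λ i → ∑-at-≤ q (λ y → 𝟙 (adj B (at p i) y ∧ not (adj B' (at p i) y)))) ⟩
        sum (λ i → sum λ y → 𝟙 (adj B (at p i) y ∧ not (adj B' (at p i) y)))
          ≤⟨ ∑-at-≤ p (λ x → sum λ y → 𝟙 (adj B x y ∧ not (adj B' x y))) ⟩
        D ∎
        where
        open ≤-Reasoning
        G≡ : ∀ i j → adj G i j ≡ (not (p == q) ∧ adj G i j)
        G≡ i j with true ← not (p == q) = refl

      twice : Fin 3 → Fin 3 → Fin n → Fin n → ℕ
      twice p q i j = missing p q i j + missing p q j i

      twice-≤ : ∀ p q → T (not (p == q)) → sum (λ i → sum (twice p q i)) ≤ 2 * D
      twice-≤ p q p≠q = begin
        sum (λ i → sum (twice p q i))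
          ≡⟨ trans (sum-cong-≗ (λ i → ∑-distrib-+ {n} (missing p q i) _)) (∑-distrib-+ {n} _ _) ⟩
        sum (λ i → sum (missing p q i)) + sum (λ i → sum λ j → missing p q j i)
          ≡⟨ cong (sum (λ i → sum (missing p q i)) +_) (∑-comm (λ i j → missing p q j i)) ⟩
        sum (λ i → sum (missing p q i)) + sum (λ j → sum (missing p q j))
          ≤⟨ +-mono-≤ (missing-≤ p q p≠q) (missing-≤ p q p≠q) ⟩
        D + D
          ≡⟨ cong (D +_) (+-identityʳ D) ⟨
        2 * D ∎
        where open ≤-Reasoning

      pointwise-∧ : ∀ g x y → 𝟙 (g ∧ not (x ∧ y)) ≤ 𝟙 (g ∧ not x) + 𝟙 (g ∧ not y)
      pointwise-∧ false x y = z≤n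
      pointwise-∧ true true y = ≤-refl
      pointwise-∧ true false y = s≤s z≤n

      pointwise : ∀ i j → 𝟙 (adj G i j ∧ not (a i j)) ≤ twice 0F 1F i j + (twice 0F 2F i j + twice 1F 2F i j)
      pointwise i j = ≤-trans (pointwise-∧ g (both 0F 1F i j) _)
        (+-mono-≤ (half 0F 1F)
          (≤-trans (pointwise-∧ g (both 0F 2F i j) _) (+-mono-≤ (half 0F 2F) (half 1F 2F))))
        where
        g = adj G i j
        half : ∀ p q → 𝟙 (g ∧ not (both p q i j)) ≤ twice p q i j
        half p q = ≤-trans (pointwise-∧ g (e p q i j) (e p q j i))
          (≤-reflexive (cong (λ b → missing p q i j + 𝟙 (b ∧ not (e p q j i))) (Graph.sym G i j)))

    -- A lost pair misses one of the six edges above it, and each of the six kinds of missing edge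
    -- embeds into the pairs deleted from `B`.
    common-deleted : deletedPairs G common ≤ 6 * D
    common-deleted = begin
      deletedPairs G common
        ≤⟨ ∑-mono (λ i → ∑-mono (pointwise i)) ⟩
      sum (λ i → sum λ j → twice 0F 1F i j + (twice 0F 2F i j + twice 1F 2F i j))
        ≡⟨ trans (sum-cong-≗ (λ i → ∑-distrib-+ {n} (twice 0F 1F i) _)) (∑-distrib-+ {n} _ _) ⟩
      sum (λ i → sum (twice 0F 1F i)) + sum (λ i → sum λ j → twice 0F 2F i j + twice 1F 2F i j)
        ≡⟨ cong (sum (λ i → sum (twice 0F 1F i)) +_)
             (trans (sum-cong-≗ (λ i → ∑-distrib-+ {n} (twice 0F 2F i) _)) (∑-distrib-+ {n} _ _)) ⟩
      sum (λ i → sum (twice 0F 1F i)) + (sum (λ i → sum (twice 0F 2F i)) + sum (λ i → sum (twice 1F 2F i)))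
        ≤⟨ +-mono-≤ (twice-≤ 0F 1F tt) (+-mono-≤ (twice-≤ 0F 2F tt) (twice-≤ 1F 2F tt)) ⟩
      2 * D + (2 * D + 2 * D)
        ≡⟨ six D ⟩
      6 * D ∎
      where
      open ≤-Reasoning
      six : ∀ d → 2 * d + (2 * d + 2 * d) ≡ 6 * d
      six = solve-∀

-- Rational arithmetic

∑∑-adj : ∀ {n} (G : Graph n) → 2 * edges G ≡ sum λ i → sum λ j → 𝟙 (adj G i j)
∑∑-adj {n} G = trans (!-*-copiesK 2 G)
  (sum-cong-≗ {n} λ i → trans (*-identityˡ _) (sum-cong-≗ {n} λ j → *-identityʳ _))

-- The inclusion splits the edges of `G` into those of `G'` and the deleted ones, so the truncated
-- subtraction is exact.
2*deletedEdges : ∀ {n} (G G' : Graph n) → G' ⊆G G → 2 * (edges G ∸ edges G') ≡ deletedPairs G G'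
2*deletedEdges {n} G G' G'⊆G = begin
  2 * (edges G ∸ edges G')
    ≡⟨ *-distribˡ-∸ 2 (edges G) (edges G') ⟩
  2 * edges G ∸ 2 * edges G'
    ≡⟨ cong₂ _∸_ split (∑∑-adj G') ⟩
  e' + deletedPairs G G' ∸ e'
    ≡⟨ m+n∸m≡n e' _ ⟩
  deletedPairs G G' ∎
  where
  open ≡-Reasoning
  e' = sum λ i → sum λ j → 𝟙 (adj G' i j)
  pointwise : ∀ b c → (T c → T b) → 𝟙 b ≡ 𝟙 c + 𝟙 (b ∧ not c)
  pointwise true true h = refl
  pointwise true false h = refl
  pointwise false true h = ⊥-elim (h tt)
  pointwise false false h = refl
  split : 2 * edges G ≡ e' + deletedPairs G G'
  split = trans (∑∑-adj G) (trans
    (sum-cong-≗ λ i → trans (sum-cong-≗ λ j → pointwise (adj G i j) (adj G' i j) (G'⊆G i j))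
      (∑-distrib-+ {n} _ _))
    (∑-distrib-+ {n} _ _))

-- Normalisation to lowest terms does not compute on a variable, so identities for `ℕ→ℚ` are checked
-- on unnormalised fractions.
toℚᵘ-ℕ→ℚ : ∀ m → toℚᵘ (ℕ→ℚ m) ℚᵘ.≃ ℚᵘ.mkℚᵘ (ℤ.+ m) 0
toℚᵘ-ℕ→ℚ m = ℚ.toℚᵘ-fromℚᵘ (ℚᵘ.mkℚᵘ (ℤ.+ m) 0)

ℕ→ℚ-+ : ∀ a b → ℕ→ℚ (a + b) ≡ ℕ→ℚ a ℚ.+ ℕ→ℚ b
ℕ→ℚ-+ a b = ℚ.toℚᵘ-injective (begin
  toℚᵘ (ℕ→ℚ (a + b))                         ≈⟨ toℚᵘ-ℕ→ℚ (a + b) ⟩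
  ℚᵘ.mkℚᵘ (ℤ.+ (a + b)) 0                       ≈⟨ ℚᵘ.*≡* (cong (ℤ._* ℤ.+ 1) (trans (ℤ.pos-+ a b) (sym (cong₂ ℤ._+_ (ℤ.*-identityʳ (ℤ.+ a)) (ℤ.*-identityʳ (ℤ.+ b)))))) ⟩
  ℚᵘ.mkℚᵘ (ℤ.+ a) 0 ℚᵘ.+ ℚᵘ.mkℚᵘ (ℤ.+ b) 0        ≈⟨ ℚᵘ.+-cong (toℚᵘ-ℕ→ℚ a) (toℚᵘ-ℕ→ℚ b) ⟨
  toℚᵘ (ℕ→ℚ a) ℚᵘ.+ toℚᵘ (ℕ→ℚ b)              ≈⟨ ℚ.toℚᵘ-homo-+ (ℕ→ℚ a) (ℕ→ℚ b) ⟨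
  toℚᵘ (ℕ→ℚ a ℚ.+ ℕ→ℚ b)                      ∎)
  where open ℚᵘ.≃-Reasoning

/-cancel : ∀ a b → ((ℤ.+ a) ℚ./ suc b) ℚ.* ℕ→ℚ (suc b) ≡ ℕ→ℚ a
/-cancel a b = ℚ.toℚᵘ-injective (begin
  toℚᵘ ((ℤ.+ a ℚ./ suc b) ℚ.* ℕ→ℚ (suc b))             ≈⟨ ℚ.toℚᵘ-homo-* (ℤ.+ a ℚ./ suc b) (ℕ→ℚ (suc b)) ⟩
  toℚᵘ (ℤ.+ a ℚ./ suc b) ℚᵘ.* toℚᵘ (ℕ→ℚ (suc b))       ≈⟨ ℚᵘ.*-cong (ℚ.toℚᵘ-fromℚᵘ (ℚᵘ.mkℚᵘ (ℤ.+ a) b)) (toℚᵘ-ℕ→ℚ (suc b)) ⟩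
  ℚᵘ.mkℚᵘ (ℤ.+ a) b ℚᵘ.* ℚᵘ.mkℚᵘ (ℤ.+ suc b) 0           ≈⟨ ℚᵘ.*≡* (trans (ℤ.*-identityʳ _) (cong (λ d → ℤ.+ a ℤ.* ℤ.+ d) (sym (*-identityʳ (suc b))))) ⟩
  ℚᵘ.mkℚᵘ (ℤ.+ a) 0                                    ≈⟨ toℚᵘ-ℕ→ℚ a ⟨
  toℚᵘ (ℕ→ℚ a)                                       ∎)
  where open ℚᵘ.≃-Reasoning

ℕ→ℚ-* : ∀ a b → ℕ→ℚ (a * b) ≡ ℕ→ℚ a ℚ.* ℕ→ℚ b
ℕ→ℚ-* a b = ℚ.toℚᵘ-injective (begin
  toℚᵘ (ℕ→ℚ (a * b))                         ≈⟨ toℚᵘ-ℕ→ℚ (a * b) ⟩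
  ℚᵘ.mkℚᵘ (ℤ.+ (a * b)) 0                       ≈⟨ ℚᵘ.*≡* (cong (ℤ._* ℤ.+ 1) (ℤ.pos-* a b)) ⟩
  ℚᵘ.mkℚᵘ (ℤ.+ a) 0 ℚᵘ.* ℚᵘ.mkℚᵘ (ℤ.+ b) 0        ≈⟨ ℚᵘ.*-cong (toℚᵘ-ℕ→ℚ a) (toℚᵘ-ℕ→ℚ b) ⟨
  toℚᵘ (ℕ→ℚ a) ℚᵘ.* toℚᵘ (ℕ→ℚ b)              ≈⟨ ℚ.toℚᵘ-homo-* (ℕ→ℚ a) (ℕ→ℚ b) ⟨
  toℚᵘ (ℕ→ℚ a ℚ.* ℕ→ℚ b)                      ∎)
  where open ℚᵘ.≃-Reasoning

ℕ→ℚ-^ : ∀ n k → ℕ→ℚ n ^ℚ k ≡ ℕ→ℚ (n ^ k)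
ℕ→ℚ-^ n zero = refl
ℕ→ℚ-^ n (suc k) = trans (cong (ℕ→ℚ n ℚ.*_) (ℕ→ℚ-^ n k)) (sym (ℕ→ℚ-* n (n ^ k)))

ℕ→ℚ-mono-≤ : ∀ a b → a ≤ b → ℕ→ℚ a ℚ.≤ ℕ→ℚ b
ℕ→ℚ-mono-≤ a b a≤b = ℚ.toℚᵘ-cancel-≤ (ℚᵘ.≤-respˡ-≃ (ℚᵘ.≃-sym (toℚᵘ-ℕ→ℚ a))
  (ℚᵘ.≤-respʳ-≃ (ℚᵘ.≃-sym (toℚᵘ-ℕ→ℚ b))
    (ℚᵘ.*≤* (ℤ.*-monoʳ-≤-nonNeg (ℤ.+ 1) (ℤ.+≤+ a≤b)))))

ℕ→ℚ-cancel-≤ : ∀ a b → ℕ→ℚ a ℚ.≤ ℕ→ℚ b → a ≤ b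
ℕ→ℚ-cancel-≤ a b h with ℚᵘ.≤-respˡ-≃ (toℚᵘ-ℕ→ℚ a) (ℚᵘ.≤-respʳ-≃ (toℚᵘ-ℕ→ℚ b) (ℚ.toℚᵘ-mono-≤ h))
... | ℚᵘ.*≤* h' = ℤ.drop‿+≤+ (ℤ.*-cancelʳ-≤-pos (ℤ.+ a) (ℤ.+ b) (ℤ.+ 1) h')

ℕ→ℚ-mono-< : ∀ a b → a < b → ℕ→ℚ a ℚ.< ℕ→ℚ b
ℕ→ℚ-mono-< a b a<b = ℚ.≰⇒> λ b≤a → <⇒≱ a<b (ℕ→ℚ-cancel-≤ b a b≤a)

ℕ→ℚ-nonNeg : ∀ m → ℚ.NonNegative (ℕ→ℚ m)
ℕ→ℚ-nonNeg m = ℚ.nonNegative (ℕ→ℚ-mono-≤ 0 m z≤n)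

ℕ→ℚ-pos : ∀ m → ℚ.Positive (ℕ→ℚ (suc m))
ℕ→ℚ-pos m = ℚ.positive (ℕ→ℚ-mono-< 0 (suc m) (s≤s z≤n))

-- The denominator of `α` in lowest terms is a witness: multiplying by it leaves the positive
-- numerator.
archimedean : ∀ α → 0ℚ ℚ.< α → ∃[ d ] (1ℚ ℚ.≤ α ℚ.* ℕ→ℚ (suc d))
archimedean α 0<α with ℚ.positive 0<α
archimedean (mkℚ +[1+ a ] d c) 0<α | _ = d ,
  subst (1ℚ ℚ.≤_) (trans (sym (/-cancel (suc a) d)) (cong (ℚ._* ℕ→ℚ (suc d)) (ℚ.normalize-coprime c)))
    (ℕ→ℚ-mono-≤ 1 (suc a) (s≤s z≤n))


-- Reduction of K_r-removal to triangle removal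

-- Writing `w` as a successor makes the joined sets nonempty, and `n ≤ w` bounds the order
-- `3 * (n + w)` of `B` by three times their size `w + w`, as `tower-descent` requires.
module Construction {n} (G : Graph n) (w' : ℕ) (n≤w : n ≤ suc w') (s : ℕ) where

  w : ℕ
  w = suc w'

  open Blowup G w using (B; B-no-K₄; B-triangles; B-deg; common; common⊆G; common-free; common-deleted)

  order : ℕ
  order = towerSize (w + w) (3 * (n + w)) s

  H : Graph order
  H = tower (w + w) B s

  order-≡ : order ≡ s * (w + w) + 3 * (n + w)
  order-≡ = towerSize-≡ (w + w) (3 * (n + w)) s

  H-copies : copiesK (3 + s) H ≤ (w + w) ^ s * 27 * copiesK 3 G
  H-copies = begin
    copiesK (3 + s) H                  ≡⟨ copiesK-tower B B-no-K₄ (w + w) s ⟩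
    (w + w) ^ s * copiesK 3 B          ≤⟨ *-monoʳ-≤ ((w + w) ^ s) B-triangles ⟩
    (w + w) ^ s * (27 * copiesK 3 G)   ≡⟨ *-assoc ((w + w) ^ s) 27 (copiesK 3 G) ⟨
    (w + w) ^ s * 27 * copiesK 3 G     ∎
    where open ≤-Reasoning

  H-deg : ∀ v → s * (w + w) + w ≤ deg H v
  H-deg = deg-tower (w + w) B w (≤-trans (m≤n+m (w + (w + w)) (3 * n)) (≤-reflexive (regroup n w))) B-deg s
    where
    regroup : ∀ n w → 3 * n + (w + (w + w)) ≡ 3 * (n + w)
    regroup = solve-∀

  H-descent : ∀ H' → H' ⊆G H → copiesK (3 + s) H' ≡ 0 →
    Σ (Graph n) λ G' → (G' ⊆G G) × (copiesK 3 G' ≡ 0) ×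
      (edges G ∸ edges G' ≤ 6 * towerLoss s * (edges H ∸ edges H'))
  H-descent H' H'⊆H H'-free =
    let B' , B'⊆B , B'-free , lossB = tower-descent (w' + w) B
          (*-monoʳ-≤ 3 (+-monoˡ-≤ w n≤w)) s H' H'⊆H H'-free
        G' = common B' B'⊆B B'-free
        G'⊆G = common⊆G B' B'⊆B B'-free
    in G' , G'⊆G , common-free B' B'⊆B B'-free ,
       chain (edges G ∸ edges G') (edges H ∸ edges H') (2*deletedEdges G G' G'⊆G)
         (common-deleted B' B'⊆B B'-free) lossB (2*deletedEdges H H' H'⊆H)
    where
    open ≤-Reasoning
    chain : ∀ x y {D D₁ D₂} → 2 * x ≡ D → D ≤ 6 * D₁ → D₁ ≤ towerLoss s * D₂ → 2 * y ≡ D₂ →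
      x ≤ 6 * towerLoss s * y
    chain x y {D} {D₁} {D₂} 2x≡ D≤ D₁≤ 2y≡ = *-cancelˡ-≤ 2 (begin
      2 * x                            ≡⟨ 2x≡ ⟩
      D                                ≤⟨ D≤ ⟩
      6 * D₁                           ≤⟨ *-monoʳ-≤ 6 D₁≤ ⟩
      6 * (towerLoss s * D₂)           ≡⟨ cong (λ d → 6 * (towerLoss s * d)) 2y≡ ⟨
      6 * (towerLoss s * (2 * y))      ≡⟨ regroup (towerLoss s) y ⟩
      2 * (6 * towerLoss s * y)        ∎)
      where
      regroup : ∀ κ d → 6 * (κ * (2 * d)) ≡ 2 * (6 * κ * d)
      regroup = solve-∀

  -- The growth in copies is paid for by the growth in order, so the same `δ` serves for `G` and
  -- `H`. Both `3 * n` and `w + w` are at most the order, and `27 * n ^ 3` is the cube of `3 * n`.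
  order-power : (w + w) ^ s * 27 * n ^ 3 ≤ order ^ (3 + s)
  order-power = begin
    (w + w) ^ s * 27 * n ^ 3      ≡⟨ regroup ((w + w) ^ s) n ⟩
    (3 * n) ^ 3 * (w + w) ^ s     ≤⟨ *-mono-≤ (^-monoˡ-≤ 3 3n≤) (^-monoˡ-≤ s 2w≤) ⟩
    order ^ 3 * order ^ s         ≡⟨ ^-distribˡ-+-* order 3 s ⟨
    order ^ (3 + s)               ∎
    where
    open ≤-Reasoning
    regroup : ∀ x n → x * 27 * (n * (n * (n * 1))) ≡ (3 * n) * ((3 * n) * ((3 * n) * 1)) * x
    regroup = solve-∀
    split₁ : ∀ y n w → (y + 3 * w) + 3 * n ≡ y + 3 * (n + w)
    split₁ = solve-∀
    split₂ : ∀ y n w → (y + 3 * n + w) + (w + w) ≡ y + 3 * (n + w)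
    split₂ = solve-∀
    3n≤ : 3 * n ≤ order
    3n≤ = ≤-trans (m≤n+m _ (s * (w + w) + 3 * w))
      (≤-reflexive (trans (split₁ (s * (w + w)) n w) (sym order-≡)))
    2w≤ : w + w ≤ order
    2w≤ = ≤-trans (m≤n+m _ (s * (w + w) + 3 * n + w))
      (≤-reflexive (trans (split₂ (s * (w + w)) n w) (sym order-≡)))

thr-≡ : ∀ s → thr (3 + s) ≡ (ℤ.+ (1 + 2 * s)) ℚ./ suc (2 + 2 * s)
thr-≡ s = cong₂ (λ a b → (ℤ.+ a) ℚ./ suc b)
  (trans (cong (_∸ 5) (double s)) (m+n∸m≡n 5 _)) (trans (cong (_∸ 4) (double' s)) (m+n∸m≡n 4 _))
  where
  double : ∀ s → 2 * (3 + s) ≡ 5 + (1 + 2 * s)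
  double = solve-∀
  double' : ∀ s → 2 * (3 + s) ≡ 4 + (2 + 2 * s)
  double' = solve-∀

/-*-≤ : ∀ a b N X → a * N ≤ suc b * X → ((ℤ.+ a) ℚ./ suc b) ℚ.* ℕ→ℚ N ℚ.≤ ℕ→ℚ X
/-*-≤ a b N X aN≤ = ℚ.*-cancelʳ-≤-pos (ℕ→ℚ (suc b)) {{ℕ→ℚ-pos b}} (begin
  q ℚ.* ℕ→ℚ N ℚ.* ℕ→ℚ (suc b)    ≡⟨ swapʳ q (ℕ→ℚ N) (ℕ→ℚ (suc b)) ⟩
  q ℚ.* ℕ→ℚ (suc b) ℚ.* ℕ→ℚ N    ≡⟨ cong (ℚ._* ℕ→ℚ N) (/-cancel a b) ⟩
  ℕ→ℚ a ℚ.* ℕ→ℚ N                ≡⟨ ℕ→ℚ-* a N ⟨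
  ℕ→ℚ (a * N)                    ≤⟨ ℕ→ℚ-mono-≤ (a * N) (suc b * X) aN≤ ⟩
  ℕ→ℚ (suc b * X)                ≡⟨ trans (ℕ→ℚ-* (suc b) X) (ℚ.*-comm (ℕ→ℚ (suc b)) (ℕ→ℚ X)) ⟩
  ℕ→ℚ X ℚ.* ℕ→ℚ (suc b)          ∎)
  where
  open ℚ.≤-Reasoning
  q = (ℤ.+ a) ℚ./ suc b
  swapʳ : ∀ x y z → x ℚ.* y ℚ.* z ≡ x ℚ.* z ℚ.* y
  swapʳ x y z = trans (ℚ.*-assoc x y z) (trans (cong (x ℚ.*_) (ℚ.*-comm y z)) (sym (ℚ.*-assoc x z y)))

≤-α*ℕ : ∀ α d → 1ℚ ℚ.≤ α ℚ.* ℕ→ℚ (suc d) → ∀ m N → suc d * m ≤ N → 0ℚ ℚ.≤ α → ℕ→ℚ m ℚ.≤ α ℚ.* ℕ→ℚ N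
≤-α*ℕ α d 1≤αd m N dm≤N 0≤α = begin
  ℕ→ℚ m                                ≡⟨ ℚ.*-identityˡ (ℕ→ℚ m) ⟨
  1ℚ ℚ.* ℕ→ℚ m                         ≤⟨ ℚ.*-monoʳ-≤-nonNeg (ℕ→ℚ m) {{ℕ→ℚ-nonNeg m}} 1≤αd ⟩
  α ℚ.* ℕ→ℚ (suc d) ℚ.* ℕ→ℚ m          ≡⟨ ℚ.*-assoc α (ℕ→ℚ (suc d)) (ℕ→ℚ m) ⟩
  α ℚ.* (ℕ→ℚ (suc d) ℚ.* ℕ→ℚ m)        ≡⟨ cong (α ℚ.*_) (ℕ→ℚ-* (suc d) m) ⟨
  α ℚ.* ℕ→ℚ (suc d * m)                ≤⟨ ℚ.*-monoˡ-≤-nonNeg α {{ℚ.nonNegative 0≤α}} (ℕ→ℚ-mono-≤ (suc d * m) N dm≤N) ⟩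
  α ℚ.* ℕ→ℚ N                          ∎
  where open ℚ.≤-Reasoning

-- The shortfall `e` from the ideal degree is absorbed by the slack `α`.
minimum-degree : ∀ t α a e N → t ℚ.* ℕ→ℚ N ℚ.≤ ℕ→ℚ (a + e) → ℕ→ℚ e ℚ.≤ α ℚ.* ℕ→ℚ N →
  (t ℚ.- α) ℚ.* ℕ→ℚ N ℚ.≤ ℕ→ℚ a
minimum-degree t α a e N tN≤ e≤ = begin
  (t ℚ.- α) ℚ.* ℕ→ℚ N                         ≡⟨ ℚ.*-distribʳ-+ (ℕ→ℚ N) t (ℚ.- α) ⟩
  t ℚ.* ℕ→ℚ N ℚ.+ (ℚ.- α) ℚ.* ℕ→ℚ N           ≡⟨ cong (t ℚ.* ℕ→ℚ N ℚ.+_) (ℚ.neg-distribˡ-* α (ℕ→ℚ N)) ⟨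
  t ℚ.* ℕ→ℚ N ℚ.- α ℚ.* ℕ→ℚ N                 ≤⟨ ℚ.+-mono-≤ tN≤ (ℚ.neg-antimono-≤ e≤) ⟩
  ℕ→ℚ (a + e) ℚ.- ℕ→ℚ e                       ≡⟨ cong (ℚ._- ℕ→ℚ e) (ℕ→ℚ-+ a e) ⟩
  ℕ→ℚ a ℚ.+ ℕ→ℚ e ℚ.- ℕ→ℚ e                   ≡⟨ ℚ.+-assoc (ℕ→ℚ a) (ℕ→ℚ e) _ ⟩
  ℕ→ℚ a ℚ.+ (ℕ→ℚ e ℚ.- ℕ→ℚ e)                 ≡⟨ cong (ℕ→ℚ a ℚ.+_) (ℚ.+-inverseʳ (ℕ→ℚ e)) ⟩
  ℕ→ℚ a ℚ.+ 0ℚ                                ≡⟨ ℚ.+-identityʳ (ℕ→ℚ a) ⟩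
  ℕ→ℚ a                                       ∎
  where open ℚ.≤-Reasoning

-- The factor is written `suc M` because multiplying by a positive number preserves the strict
-- inequality.
few-copies : ∀ δ → 0ℚ ℚ.≤ δ → ∀ M c c' n N k → c' ≤ suc M * c → suc M * n ^ 3 ≤ N ^ k →
  ℕ→ℚ c ℚ.< δ ℚ.* (ℕ→ℚ n ^ℚ 3) → ℕ→ℚ c' ℚ.< δ ℚ.* (ℕ→ℚ N ^ℚ k)
few-copies δ 0≤δ M c c' n N k c'≤ Mn≤ c< = begin-strict
  ℕ→ℚ c'                                 ≤⟨ ℕ→ℚ-mono-≤ c' (suc M * c) c'≤ ⟩
  ℕ→ℚ (suc M * c)                        ≡⟨ ℕ→ℚ-* (suc M) c ⟩
  ℕ→ℚ (suc M) ℚ.* ℕ→ℚ c                  <⟨ ℚ.*-monoʳ-<-pos (ℕ→ℚ (suc M)) {{ℕ→ℚ-pos M}} c< ⟩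
  ℕ→ℚ (suc M) ℚ.* (δ ℚ.* (ℕ→ℚ n ^ℚ 3))   ≡⟨ cong (λ x → ℕ→ℚ (suc M) ℚ.* (δ ℚ.* x)) (ℕ→ℚ-^ n 3) ⟩
  ℕ→ℚ (suc M) ℚ.* (δ ℚ.* ℕ→ℚ (n ^ 3))    ≡⟨ swap (ℕ→ℚ (suc M)) δ (ℕ→ℚ (n ^ 3)) ⟩
  δ ℚ.* (ℕ→ℚ (suc M) ℚ.* ℕ→ℚ (n ^ 3))    ≡⟨ cong (δ ℚ.*_) (ℕ→ℚ-* (suc M) (n ^ 3)) ⟨
  δ ℚ.* ℕ→ℚ (suc M * n ^ 3)              ≤⟨ ℚ.*-monoˡ-≤-nonNeg δ {{ℚ.nonNegative 0≤δ}} (ℕ→ℚ-mono-≤ (suc M * n ^ 3) (N ^ k) Mn≤) ⟩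
  δ ℚ.* ℕ→ℚ (N ^ k)                      ≡⟨ cong (δ ℚ.*_) (ℕ→ℚ-^ N k) ⟨
  δ ℚ.* (ℕ→ℚ N ^ℚ k)                     ∎
  where
  open ℚ.≤-Reasoning
  swap : ∀ x y z → x ℚ.* (y ℚ.* z) ≡ y ℚ.* (x ℚ.* z)
  swap x y z = trans (sym (ℚ.*-assoc x y z)) (trans (cong (ℚ._* z) (ℚ.*-comm x y)) (ℚ.*-assoc y x z))

few-deletions : ∀ ε κ D D' c n N → N ≡ c * n → D' ≤ κ * D → ℕ→ℚ D ℚ.≤ ε ℚ.* (ℕ→ℚ N ^ℚ 2) →
  ℕ→ℚ D' ℚ.≤ ℕ→ℚ (κ * c ^ 2) ℚ.* ε ℚ.* (ℕ→ℚ n ^ℚ 2)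
few-deletions ε κ D D' c n N N≡ D'≤ D≤ = begin
  ℕ→ℚ D'                                   ≤⟨ ℕ→ℚ-mono-≤ D' (κ * D) D'≤ ⟩
  ℕ→ℚ (κ * D)                              ≡⟨ ℕ→ℚ-* κ D ⟩
  ℕ→ℚ κ ℚ.* ℕ→ℚ D                          ≤⟨ ℚ.*-monoˡ-≤-nonNeg (ℕ→ℚ κ) {{ℕ→ℚ-nonNeg κ}} D≤ ⟩
  ℕ→ℚ κ ℚ.* (ε ℚ.* (ℕ→ℚ N ^ℚ 2))           ≡⟨ cong (λ x → ℕ→ℚ κ ℚ.* (ε ℚ.* x)) N²≡ ⟩
  ℕ→ℚ κ ℚ.* (ε ℚ.* (ℕ→ℚ (c ^ 2) ℚ.* ℕ→ℚ (n ^ 2)))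
                                           ≡⟨ regroup (ℕ→ℚ κ) ε (ℕ→ℚ (c ^ 2)) (ℕ→ℚ (n ^ 2)) ⟩
  ℕ→ℚ κ ℚ.* ℕ→ℚ (c ^ 2) ℚ.* ε ℚ.* ℕ→ℚ (n ^ 2)
                                           ≡⟨ cong₂ (λ x y → x ℚ.* ε ℚ.* y) (ℕ→ℚ-* κ (c ^ 2)) (ℕ→ℚ-^ n 2) ⟨
  ℕ→ℚ (κ * c ^ 2) ℚ.* ε ℚ.* (ℕ→ℚ n ^ℚ 2)   ∎
  where
  open ℚ.≤-Reasoning
  square-* : ∀ c n → (c * n) * ((c * n) * 1) ≡ (c * (c * 1)) * (n * (n * 1))
  square-* = solve-∀
  N²≡ : ℕ→ℚ N ^ℚ 2 ≡ ℕ→ℚ (c ^ 2) ℚ.* ℕ→ℚ (n ^ 2)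
  N²≡ = trans (ℕ→ℚ-^ N 2) (trans (cong ℕ→ℚ (trans (cong (_^ 2) N≡) (square-* c n)))
    (ℕ→ℚ-* (c ^ 2) (n ^ 2)))
  regroup : ∀ x y z u → x ℚ.* (y ℚ.* (z ℚ.* u)) ≡ x ℚ.* z ℚ.* y ℚ.* u
  regroup = ℚ.+-*-Solver.solve 4 (λ x y z u → x :* (y :* (z :* u)) := x :* z :* y :* u) refl
    where open ℚ.+-*-Solver

-- The constant combines the factor `κ` lost in returning from `H` to `G` with `c ^ 2`, which
-- converts the squared order of `H` to the squared order of `G`.
removal-reduction : ∀ s α → 0ℚ ℚ.< α → ∃[ C ] (0 < C) × ∀ ε δ → 0ℚ ℚ.≤ δ →
  RemovalProp (3 + s) ε (thr (3 + s) ℚ.- α) δ → RemovalProp 3 (ℕ→ℚ C ℚ.* ε) (ℕ→ℚ 0) δ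
removal-reduction s α 0<α = κ * c ^ 2 , >-nonZero⁻¹ (κ * c ^ 2) {{m*n≢0 κ (c ^ 2) {{_}} {{m^n≢0 c 2}}}} , reduce
  where
  d = proj₁ (archimedean α 0<α)
  -- With `w = K * n`, the error `3 * n` in the degree satisfies `suc d * (3 * n) = w`. As `suc d`
  -- is at least the reciprocal of `α`, the error is at most `α` times the order.
  K = 3 * suc d
  c = 3 * (1 + K) + s * (K + K)
  -- The added 1 makes `κ` visibly nonzero, as needed for a positive constant.
  κ = 1 + 6 * towerLoss s

  reduce : ∀ ε δ → 0ℚ ℚ.≤ δ →
    RemovalProp (3 + s) ε (thr (3 + s) ℚ.- α) δ → RemovalProp 3 (ℕ→ℚ (κ * c ^ 2) ℚ.* ε) (ℕ→ℚ 0) δ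
  -- For an empty graph `w` would be zero; there the hypothesis of few triangles reads `0 < 0`.
  reduce ε δ 0≤δ removal zero G c<0 _ = ⊥-elim (ℚ.<-irrefl refl
    (subst (ℕ→ℚ (copiesK 3 G) ℚ.<_) (ℚ.*-zeroʳ δ) c<0))
  reduce ε δ 0≤δ removal (suc n') G c< _ =
    let H' , H'⊆H , H'-free , H'-deleted = removal order H
          (few-copies δ 0≤δ (pred M) (copiesK 3 G) (copiesK (3 + s) H) n order (3 + s)
            (≤-trans H-copies (*-monoˡ-≤ (copiesK 3 G) (≤-reflexive M≡)))
            (≤-trans (*-monoˡ-≤ (n ^ 3) (≤-reflexive (sym M≡))) order-power) c<)
          (λ v → ℚ.≤-trans
            (minimum-degree (thr (3 + s)) α (s * (w + w) + w) (3 * n) order thr-order extra)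
            (ℕ→ℚ-mono-≤ _ (deg H v) (H-deg v)))
        G' , G'⊆G , G'-free , G'-deleted = H-descent H' H'⊆H H'-free
    in G' , G'⊆G , G'-free ,
       few-deletions ε κ (edges H ∸ edges H') (edges G ∸ edges G') c n order order-≡cn
         (suc-≤ (6 * towerLoss s) (edges G ∸ edges G') (edges H ∸ edges H') G'-deleted) H'-deleted
    where
    n = suc n'
    w₀ = K * n
    open Construction G (pred w₀) (m≤n*m n K) s
    suc-≤ : ∀ κ x y → x ≤ κ * y → x ≤ suc κ * y
    suc-≤ κ x y h = ≤-trans h (m≤n+m (κ * y) y)
    M = (w + w) ^ s * 27
    M≡ : M ≡ suc (pred M)
    M≡ = sym (suc-pred M {{m*n≢0 ((w + w) ^ s) 27 {{m^n≢0 (w + w) s}}}})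
    order-≡cn : order ≡ c * n
    order-≡cn = trans order-≡ (scale s K n)
      where
      scale : ∀ s K n → s * (K * n + K * n) + 3 * (n + K * n) ≡ (3 * (1 + K) + s * (K + K)) * n
      scale = solve-∀
    -- For `n = 0` the ratio of `s * (w + w) + w` to the order `s * (w + w) + 3 * w` is exactly the
    -- threshold. The summand `3 * n` compensates for the copies of `G`.
    thr-order : thr (3 + s) ℚ.* ℕ→ℚ order ℚ.≤ ℕ→ℚ (s * (w + w) + w + 3 * n)
    thr-order = subst (λ t → t ℚ.* ℕ→ℚ order ℚ.≤ ℕ→ℚ (s * (w + w) + w + 3 * n)) (sym (thr-≡ s))
      (/-*-≤ (1 + 2 * s) (2 + 2 * s) order (s * (w + w) + w + 3 * n)
        (≤-trans (m≤m+n _ (6 * n)) (≤-reflexive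
          (trans (cong (λ m → (1 + 2 * s) * m + 6 * n) order-≡) (balance s w n)))))
      where
      balance : ∀ s w n → (1 + 2 * s) * (s * (w + w) + 3 * (n + w)) + 6 * n
        ≡ suc (2 + 2 * s) * (s * (w + w) + w + 3 * n)
      balance = solve-∀
    extra : ℕ→ℚ (3 * n) ℚ.≤ α ℚ.* ℕ→ℚ order
    extra = ≤-α*ℕ α d (proj₂ (archimedean α 0<α)) (3 * n) order (begin
      suc d * (3 * n)             ≡⟨ regroup (suc d) n ⟩
      w                           ≤⟨ m≤n+m w (s * (w + w) + 3 * n + (w + w)) ⟩
      s * (w + w) + 3 * n + (w + w) + w ≡⟨ split (s * (w + w)) n w ⟩
      s * (w + w) + 3 * (n + w)   ≡⟨ order-≡ ⟨
      order                       ∎) (ℚ.<⇒≤ 0<α)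
      where
      open ≤-Reasoning
      regroup : ∀ d n → d * (3 * n) ≡ 3 * d * n
      regroup = solve-∀
      split : ∀ y n w → y + 3 * n + (w + w) + w ≡ y + 3 * (n + w)
      split = solve-∀

-- Graphs with many edge-disjoint triangles and no others

∑-unique-≤1 : ∀ {n} (f : Fin n → Bool) → (∀ i j → T (f i) → T (f j) → i ≡ j) → sum (𝟙 ∘ f) ≤ 1
∑-unique-≤1 {zero} f unique = z≤n
∑-unique-≤1 {suc n} f unique with f zero in eq
... | false = ∑-unique-≤1 (f ∘ suc) λ i j fi fj → Fin-suc-injective (unique (suc i) (suc j) fi fj)
... | true = s≤s (≤-reflexive (∑-zero {n} λ i → 𝟙-zero (f (suc i)) λ fi →
  0≢1+n (cong toℕ (unique zero (suc i) (subst T (sym eq) tt) fi))))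
  where
  𝟙-zero : ∀ b → (T b → ⊥) → 𝟙 b ≡ 0
  𝟙-zero true h = ⊥-elim (h tt)
  𝟙-zero false h = refl

-- Each value is written with an indicator of `φ i == v`. After the sums are exchanged, every `v`
-- has at most one preimage.
∑-injective-≤ : ∀ {m n} (φ : Fin m → Fin n) → (∀ i j → φ i ≡ φ j → i ≡ j) →
  ∀ (f : Fin n → ℕ) → sum (f ∘ φ) ≤ sum f
∑-injective-≤ {m} {n} φ φ-injective f = begin
  sum (f ∘ φ)
    ≤⟨ ∑-mono (λ i → ≤-trans
         (≤-reflexive (sym (trans (cong (λ b → 𝟙 b * f (φ i)) (==-refl (φ i))) (*-identityˡ _))))
         (term-≤-∑ (λ v → 𝟙 (φ i == v) * f v) (φ i))) ⟩
  sum (λ i → sum λ v → 𝟙 (φ i == v) * f v)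
    ≡⟨ ∑-comm (λ i v → 𝟙 (φ i == v) * f v) ⟩
  sum (λ v → sum λ i → 𝟙 (φ i == v) * f v)
    ≡⟨ sum-cong-≗ (λ v → sym (*-distribʳ-sum {m} (f v) _)) ⟩
  sum (λ v → sum (λ i → 𝟙 (φ i == v)) * f v)
    ≤⟨ ∑-mono (λ v → *-monoˡ-≤ (f v) (∑-unique-≤1 (λ i → φ i == v)
         (λ i j φi≡v φj≡v → φ-injective i j (trans (==⇒≡ φi≡v) (sym (==⇒≡ φj≡v)))))) ⟩
  sum (λ v → 1 * f v)
    ≡⟨ sum-cong-≗ (λ v → *-identityˡ (f v)) ⟩
  sum f ∎
  where open ≤-Reasoning

-- Only the pair of maps is injective: a single vertex may lie in many of the chosen triangles.
-- Encoding pairs as single indices reduces this to one sum.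
∑∑-injective-≤ : ∀ {m n N} (φ ψ : Fin m → Fin n → Fin N) →
  (∀ x i y j → φ x i ≡ φ y j → ψ x i ≡ ψ y j → x ≡ y × i ≡ j) →
  ∀ (f : Fin N → Fin N → ℕ) → sum (λ x → sum λ i → f (φ x i) (ψ x i)) ≤ sum λ u → sum (f u)
∑∑-injective-≤ {m} {n} {N} φ ψ injective f = begin
  sum (λ x → sum λ i → f (φ x i) (ψ x i))
    ≡⟨ sum-cong-≗ (λ x → sum-cong-≗ λ i → sym (trans
         (cong (λ r → F (combine {N} {N} (φ (proj₁ r) (proj₂ r)) (ψ (proj₁ r) (proj₂ r)))) (remQuot-combine {m} {n} x i))
         (F-combine (φ x i) (ψ x i)))) ⟩
  sum (λ x → sum λ i → F (χ (combine {m} {n} x i)))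
    ≡⟨ ∑-combine m {n} (F ∘ χ) ⟨
  sum (F ∘ χ)
    ≤⟨ ∑-injective-≤ χ χ-injective F ⟩
  sum F
    ≡⟨ ∑-combine N {N} F ⟩
  sum (λ u → sum λ v → F (combine {N} {N} u v))
    ≡⟨ sum-cong-≗ (λ u → sum-cong-≗ λ v → F-combine u v) ⟩
  sum (λ u → sum (f u)) ∎
  where
  open ≤-Reasoning
  F : Fin (N * N) → ℕ
  F k = f (proj₁ (remQuot {N} N k)) (proj₂ (remQuot {N} N k))
  F-combine : ∀ u v → F (combine {N} {N} u v) ≡ f u v
  F-combine u v = cong (λ r → f (proj₁ r) (proj₂ r)) (remQuot-combine {N} {N} u v)
  χ : Fin (m * n) → Fin (N * N)
  χ k = combine {N} {N} (φ x i) (ψ x i)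
    where
    x = proj₁ (remQuot {m} n k)
    i = proj₂ (remQuot {m} n k)
  χ-injective : ∀ k l → χ k ≡ χ l → k ≡ l
  χ-injective k l eq =
    let φ≡ , ψ≡ = combine-injective {N} {N} _ _ _ _ eq
        x≡ , i≡ = injective _ _ _ _ φ≡ ψ≡
    in trans (sym (combine-remQuot {m} n k))
         (trans (cong₂ (combine {m} {n}) x≡ i≡) (combine-remQuot {m} n l))

-- The Ruzsa–Szemerédi graph: parts X, Y, Z and the triangles x, x + α, x + 2α for α in the set.
-- A further triangle would be a three-term progression in the set.
module RuzsaSzemerédi {a} (A : Fin a → ℕ) (Q : ℕ) (A<Q : ∀ i → A i < Q)
  (no-AP : ∀ i j k → A i + A j ≡ 2 * A k → i ≡ j) where

  -- The factor 3 leaves room for `x + 2 * A i` with `x` and `A i` below `Q`; all three parts get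
  -- the same size.
  M N : ℕ
  M = 3 * Q
  N = 3 * M

  A-injective : ∀ i j → A i ≡ A j → i ≡ j
  A-injective i j eq = no-AP i j j (trans (cong (_+ A j) eq) (cong (A j +_) (sym (+-identityʳ (A j)))))

  step₁ step₂ : Fin M → Fin M → Bool
  step₁ x y = ⌊ any? (λ i → toℕ y ≟ toℕ x + A i) ⌋
  step₂ x z = ⌊ any? (λ i → toℕ z ≟ toℕ x + 2 * A i) ⌋

  W : Set
  W = Fin 3 × Fin M

  _~_ : W → W → Bool
  (zero , x) ~ (zero , y) = false
  (zero , x) ~ (suc zero , y) = step₁ x y
  (zero , x) ~ (suc (suc zero) , z) = step₂ x z
  (suc zero , y) ~ (zero , x) = step₁ x y
  (suc zero , y) ~ (suc zero , y') = false
  (suc zero , y) ~ (suc (suc zero) , z) = step₁ y z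
  (suc (suc zero) , z) ~ (zero , x) = step₂ x z
  (suc (suc zero) , z) ~ (suc zero , y) = step₁ y z
  (suc (suc zero) , z) ~ (suc (suc zero) , z') = false

  ~-sym : ∀ u v → (u ~ v) ≡ (v ~ u)
  ~-sym (zero , _) (zero , _) = refl
  ~-sym (zero , _) (suc zero , _) = refl
  ~-sym (zero , _) (suc (suc zero) , _) = refl
  ~-sym (suc zero , _) (zero , _) = refl
  ~-sym (suc zero , _) (suc zero , _) = refl
  ~-sym (suc zero , _) (suc (suc zero) , _) = refl
  ~-sym (suc (suc zero) , _) (zero , _) = refl
  ~-sym (suc (suc zero) , _) (suc zero , _) = refl
  ~-sym (suc (suc zero) , _) (suc (suc zero) , _) = refl

  ~-irrefl : ∀ u → (u ~ u) ≡ false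
  ~-irrefl (zero , _) = refl
  ~-irrefl (suc zero , _) = refl
  ~-irrefl (suc (suc zero) , _) = refl

  decode : Fin N → W
  decode = remQuot M

  G : Graph N
  G = record
    { adj = λ u v → decode u ~ decode v
    ; sym = λ u v → ~-sym (decode u) (decode v)
    ; irrefl = λ u → ~-irrefl (decode u) }

  -- The steps from `x` to `y` and from `y` to `z` add up to twice a member of the set. This is a
  -- three-term progression, so the two steps agree.
  triangle : ∀ {x y z} → T (step₁ x y) → T (step₁ y z) → T (step₂ x z) →
    ∃[ i ] (toℕ y ≡ toℕ x + A i × toℕ z ≡ toℕ y + A i)
  triangle {x} {y} {z} xy yz xz
    with toWitness {a? = any? (λ i → toℕ y ≟ toℕ x + A i)} xy
       | toWitness {a? = any? (λ i → toℕ z ≟ toℕ y + A i)} yz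
       | toWitness {a? = any? (λ i → toℕ z ≟ toℕ x + 2 * A i)} xz
  ... | i , y≡ | j , z≡ | k , z≡' = i , y≡ , trans z≡ (cong (λ l → toℕ y + A l) (sym i≡j))
    where
    i≡j : i ≡ j
    i≡j = no-AP i j k (+-cancelˡ-≡ (toℕ x) _ _ (trans (sym (+-assoc (toℕ x) (A i) (A j)))
      (trans (cong (_+ A j) (sym y≡)) (trans (sym z≡) z≡'))))

  z-unique : ∀ {x y z z'} → T (step₁ x y) → T (step₁ y z) → T (step₂ x z) →
    T (step₁ y z') → T (step₂ x z') → z ≡ z'
  z-unique {x} {y} {z} {z'} xy yz xz yz' xz' with triangle {x} {y} {z} xy yz xz | triangle {x} {y} {z'} xy yz' xz'
  ... | i , y≡ , z≡ | j , y≡' , z≡' = toℕ-injective (trans z≡ (trans (cong (toℕ y +_)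
    (+-cancelˡ-≡ (toℕ x) _ _ (trans (sym y≡) y≡'))) (sym z≡')))

  x-unique : ∀ {x x' y z} → T (step₁ x y) → T (step₁ y z) → T (step₂ x z) →
    T (step₁ x' y) → T (step₂ x' z) → x ≡ x'
  x-unique {x} {x'} {y} {z} xy yz xz x'y x'z with triangle {x} {y} {z} xy yz xz | triangle {x'} {y} {z} x'y yz x'z
  ... | i , y≡ , z≡ | j , y≡' , z≡' = toℕ-injective (+-cancelʳ-≡ (A i) _ _ (trans (sym y≡) (trans y≡'
    (cong (toℕ x' +_) (sym (+-cancelˡ-≡ (toℕ y) _ _ (trans (sym z≡) z≡')))))))

  -- The outer vertices determine twice the common step, hence the step and the middle vertex.
  y-unique : ∀ {x y y' z} → T (step₁ x y) → T (step₁ y z) → T (step₂ x z) →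
    T (step₁ x y') → T (step₁ y' z) → y ≡ y'
  y-unique {x} {y} {y'} {z} xy yz xz xy' y'z with triangle {x} {y} {z} xy yz xz | triangle {x} {y'} {z} xy' y'z xz
  ... | i , y≡ , z≡ | j , y≡' , z≡' = toℕ-injective (trans y≡ (trans (cong (toℕ x +_) A≡) (sym y≡')))
    where
    double : ∀ i {y z} → y ≡ toℕ x + A i → z ≡ y + A i → z ≡ toℕ x + 2 * A i
    double i refl refl = trans (+-assoc (toℕ x) (A i) (A i)) (cong (λ t → toℕ x + (A i + t)) (sym (+-identityʳ (A i))))
    A≡ : A i ≡ A j
    A≡ = *-cancelˡ-≡ _ _ 2 (+-cancelˡ-≡ (toℕ x) _ _ (trans (sym (double i y≡ z≡)) (double j y≡' z≡')))

  -- A triangle meets all three parts, and two of `x`, `x + α`, `x + 2α` determine the third. The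
  -- remaining cases contain an edge inside a part.
  third-vertex-unique : ∀ u v w w' → T (u ~ v) → T (u ~ w) → T (v ~ w) → T (u ~ w') → T (v ~ w') → w ≡ w'
  third-vertex-unique (zero , x) (suc zero , y) (suc (suc zero) , z) (suc (suc zero) , z') uv uw vw uw' vw' =
    cong (suc (suc zero) ,_) (z-unique {x} {y} {z} {z'} uv vw uw vw' uw')
  third-vertex-unique (suc zero , y) (zero , x) (suc (suc zero) , z) (suc (suc zero) , z') uv uw vw uw' vw' =
    cong (suc (suc zero) ,_) (z-unique {x} {y} {z} {z'} uv uw vw uw' vw')
  third-vertex-unique (suc zero , y) (suc (suc zero) , z) (zero , x) (zero , x') uv uw vw uw' vw' =
    cong (zero ,_) (x-unique {x} {x'} {y} {z} uw uv vw uw' vw')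
  third-vertex-unique (suc (suc zero) , z) (suc zero , y) (zero , x) (zero , x') uv uw vw uw' vw' =
    cong (zero ,_) (x-unique {x} {x'} {y} {z} vw uv uw vw' uw')
  third-vertex-unique (zero , x) (suc (suc zero) , z) (suc zero , y) (suc zero , y') uv uw vw uw' vw' =
    cong (suc zero ,_) (y-unique {x} {y} {y'} {z} uw vw uv uw' vw')
  third-vertex-unique (suc (suc zero) , z) (zero , x) (suc zero , y) (suc zero , y') uv uw vw uw' vw' =
    cong (suc zero ,_) (y-unique {x} {y} {y'} {z} vw uw uv vw' uw')
  third-vertex-unique (zero , _) (suc (suc zero) , _) (suc (suc zero) , _) _ _ _ () _ _
  third-vertex-unique (zero , _) (suc (suc zero) , _) (suc zero , _) (suc (suc zero) , _) _ _ _ _ ()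
  third-vertex-unique (suc (suc zero) , _) (zero , _) (suc (suc zero) , _) _ _ () _ _ _
  third-vertex-unique (suc (suc zero) , _) (zero , _) (suc zero , _) (suc (suc zero) , _) _ _ _ () _
  third-vertex-unique (suc zero , _) (suc (suc zero) , _) (suc zero , _) _ _ () _ _ _
  third-vertex-unique (suc zero , _) (suc (suc zero) , _) (suc (suc zero) , _) _ _ _ () _ _
  third-vertex-unique (suc zero , _) (suc (suc zero) , _) (zero , _) (suc zero , _) _ _ _ () _
  third-vertex-unique (suc zero , _) (suc (suc zero) , _) (zero , _) (suc (suc zero) , _) _ _ _ _ ()
  third-vertex-unique (suc (suc zero) , _) (suc zero , _) (suc (suc zero) , _) _ _ () _ _ _
  third-vertex-unique (suc (suc zero) , _) (suc zero , _) (suc zero , _) _ _ _ () _ _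
  third-vertex-unique (suc (suc zero) , _) (suc zero , _) (zero , _) (suc (suc zero) , _) _ _ _ () _
  third-vertex-unique (suc (suc zero) , _) (suc zero , _) (zero , _) (suc zero , _) _ _ _ _ ()
  third-vertex-unique (suc (suc zero) , _) (suc (suc zero) , _) _ _ () _ _ _ _

  -- Every ordered pair of vertices has at most one completion to a triangle.
  few-triangles : copiesK 3 G ≤ N ^ 2
  few-triangles = begin
    copiesK 3 G
      ≤⟨ m≤n*m (copiesK 3 G) 6 ⟩
    6 * copiesK 3 G
      ≡⟨ trans (!-*-copiesK 3 G) (ordered₃ (adj G)) ⟩
    sum (λ u → sum λ v → sum λ w → 𝟙 (true ∧ adj G u v) * (𝟙 ((true ∧ adj G u w) ∧ adj G v w) * 1))
      ≤⟨ ∑-mono (λ u → ∑-mono λ v → at-most-one u v) ⟩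
    sum {N} (λ u → sum {N} λ v → 1)
      ≡⟨ trans (sum-cong-≗ {N} (λ u → ∑-const N 1)) (∑-const N (N * 1)) ⟩
    N ^ 2 ∎
    where
    open ≤-Reasoning
    at-most-one : ∀ u v → sum (λ w → 𝟙 (true ∧ adj G u v) * (𝟙 ((true ∧ adj G u w) ∧ adj G v w) * 1)) ≤ 1
    at-most-one u v with adj G u v in uv
    ... | false = ≤-trans (≤-reflexive (∑-zero {N} (λ w → refl))) z≤n
    ... | true = ≤-trans
      (≤-reflexive (sum-cong-≗ λ w → trans (*-identityˡ _) (*-identityʳ (𝟙 (adj G u w ∧ adj G v w)))))
      (∑-unique-≤1 (λ w → adj G u w ∧ adj G v w) λ w w' h h' →
        trans (sym (combine-remQuot {3} M w)) (trans
          (cong (λ r → combine (proj₁ r) (proj₂ r)) (third-vertex-unique (decode u) (decode v) (decode w) (decode w')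
            (subst T (sym uv) tt) (T-∧ˡ h) (T-∧ʳ (adj G u w) h) (T-∧ˡ h') (T-∧ʳ (adj G u w') h')))
          (combine-remQuot {3} M w')))

  point : Fin 3 → Fin Q → Fin a → Fin M
  point p x i = fromℕ< (bound p)
    where
    bound : ∀ (p : Fin 3) → toℕ x + toℕ p * A i < M
    bound zero = +-mono-<-≤ (toℕ<n x) z≤n
    bound (suc zero) = +-mono-<-≤ (toℕ<n x) (+-mono-≤ (<⇒≤ (A<Q i)) z≤n)
    bound (suc (suc zero)) = +-mono-<-≤ (toℕ<n x) (*-monoʳ-≤ 2 (<⇒≤ (A<Q i)))

  toℕ-point : ∀ p x i → toℕ (point p x i) ≡ toℕ x + toℕ p * A i
  toℕ-point p x i = toℕ-fromℕ< _

  vertex : Fin 3 → Fin Q → Fin a → Fin N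
  vertex p x i = combine {3} {M} p (point p x i)

  0F 1F 2F : Fin 3
  0F = zero
  1F = suc zero
  2F = suc (suc zero)

  adj-vertex : ∀ p q x i y j → adj G (vertex p x i) (vertex q y j) ≡ ((p , point p x i) ~ (q , point q y j))
  adj-vertex p q x i y j = cong₂ _~_ (remQuot-combine p (point p x i)) (remQuot-combine q (point q y j))

  edge₀₁ : ∀ x i → T (adj G (vertex 0F x i) (vertex 1F x i))
  edge₀₁ x i = subst T (sym (adj-vertex 0F 1F x i x i)) (fromWitness {a? = any? _} (i , (begin
    toℕ (point 1F x i)       ≡⟨ toℕ-point 1F x i ⟩
    toℕ x + 1 * A i          ≡⟨ cong (toℕ x +_) (*-identityˡ (A i)) ⟩
    toℕ x + A i              ≡⟨ cong (_+ A i) (trans (toℕ-point 0F x i) (+-identityʳ (toℕ x))) ⟨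
    toℕ (point 0F x i) + A i ∎)))
    where open ≡-Reasoning

  edge₁₂ : ∀ x i → T (adj G (vertex 1F x i) (vertex 2F x i))
  edge₁₂ x i = subst T (sym (adj-vertex 1F 2F x i x i)) (fromWitness {a? = any? _} (i , (begin
    toℕ (point 2F x i)       ≡⟨ toℕ-point 2F x i ⟩
    toℕ x + 2 * A i          ≡⟨ split (toℕ x) (A i) ⟩
    toℕ x + 1 * A i + A i    ≡⟨ cong (_+ A i) (toℕ-point 1F x i) ⟨
    toℕ (point 1F x i) + A i ∎)))
    where
    open ≡-Reasoning
    split : ∀ x α → x + 2 * α ≡ x + 1 * α + α
    split = solve-∀

  edge₀₂ : ∀ x i → T (adj G (vertex 0F x i) (vertex 2F x i))
  edge₀₂ x i = subst T (sym (adj-vertex 0F 2F x i x i)) (fromWitness {a? = any? _} (i , (begin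
    toℕ (point 2F x i)           ≡⟨ toℕ-point 2F x i ⟩
    toℕ x + 2 * A i              ≡⟨ cong (_+ 2 * A i) (trans (toℕ-point 0F x i) (+-identityʳ (toℕ x))) ⟨
    toℕ (point 0F x i) + 2 * A i ∎)))
    where open ≡-Reasoning

  vertex⁻ : ∀ p x i y j → vertex p x i ≡ vertex p y j → toℕ x + toℕ p * A i ≡ toℕ y + toℕ p * A j
  vertex⁻ p x i y j eq = begin
    toℕ x + toℕ p * A i    ≡⟨ toℕ-point p x i ⟨
    toℕ (point p x i)      ≡⟨ cong toℕ (proj₂ (combine-injective p (point p x i) p (point p y j) eq)) ⟩
    toℕ (point p y j)      ≡⟨ toℕ-point p y j ⟩
    toℕ y + toℕ p * A j    ∎
    where open ≡-Reasoning

  module _ {x y : Fin Q} {i j : Fin a} where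
    from₀ : ∀ q → toℕ x + 0 ≡ toℕ y + 0 → toℕ x + suc q * A i ≡ toℕ y + suc q * A j → x ≡ y × i ≡ j
    from₀ q eq₀ eq = toℕ-injective x≡y , A-injective i j (*-cancelˡ-≡ _ _ (suc q)
      (+-cancelˡ-≡ (toℕ x) _ _ (trans eq (cong (_+ suc q * A j) (sym x≡y)))))
      where
      x≡y : toℕ x ≡ toℕ y
      x≡y = +-cancelʳ-≡ 0 _ _ eq₀

    from₁₂ : toℕ x + 1 * A i ≡ toℕ y + 1 * A j → toℕ x + 2 * A i ≡ toℕ y + 2 * A j → x ≡ y × i ≡ j
    from₁₂ eq₁ eq₂ = toℕ-injective (+-cancelʳ-≡ (1 * A i) _ _ (trans eq₁ (cong (λ t → toℕ y + 1 * t) (sym A≡))))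
      , A-injective i j A≡
      where
      split : ∀ x α → x + 2 * α ≡ x + 1 * α + α
      split = solve-∀
      A≡ : A i ≡ A j
      A≡ = +-cancelˡ-≡ (toℕ x + 1 * A i) _ _ (trans (sym (split (toℕ x) (A i)))
        (trans eq₂ (trans (split (toℕ y) (A j)) (cong (_+ A j) (sym eq₁)))))

  -- The `Q * a` chosen triangles share no edge, and each must lose one. Each of the three kinds of
  -- edge embeds into the deleted ordered pairs, whose number is twice that of the deleted edges;
  -- hence the factor 6.
  many-deletions : ∀ G' → G' ⊆G G → copiesK 3 G' ≡ 0 → Q * a ≤ 6 * (edges G ∸ edges G')
  many-deletions G' G'⊆G G'-free = begin
    Q * a
      ≡⟨ trans (sym (∑-const Q a)) (sum-cong-≗ {Q} λ x → trans (sym (*-identityʳ a)) (sym (∑-const a 1))) ⟩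
    sum {Q} (λ x → sum {a} λ i → 1)
      ≤⟨ ∑-mono (λ x → ∑-mono λ i → one-missing x i) ⟩
    sum (λ x → sum λ i → missing 0F 1F x i + (missing 1F 2F x i + missing 0F 2F x i))
      ≡⟨ trans (sum-cong-≗ (λ x → ∑-distrib-+ {a} (missing 0F 1F x) _)) (∑-distrib-+ {Q} _ _) ⟩
    sum (λ x → sum (missing 0F 1F x)) + sum (λ x → sum λ i → missing 1F 2F x i + missing 0F 2F x i)
      ≡⟨ cong (sum (λ x → sum (missing 0F 1F x)) +_)
           (trans (sum-cong-≗ (λ x → ∑-distrib-+ {a} (missing 1F 2F x) _)) (∑-distrib-+ {Q} _ _)) ⟩
    sum (λ x → sum (missing 0F 1F x)) + (sum (λ x → sum (missing 1F 2F x)) + sum (λ x → sum (missing 0F 2F x)))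
      ≤⟨ +-mono-≤
           (missing-≤ 0F 1F λ x i y j e f → from₀ 0 (vertex⁻ 0F x i y j e) (vertex⁻ 1F x i y j f))
           (+-mono-≤
             (missing-≤ 1F 2F λ x i y j e f → from₁₂ (vertex⁻ 1F x i y j e) (vertex⁻ 2F x i y j f))
             (missing-≤ 0F 2F λ x i y j e f → from₀ 1 (vertex⁻ 0F x i y j e) (vertex⁻ 2F x i y j f))) ⟩
    D + (D + D)
      ≡⟨ cong (λ d → d + (d + d)) (2*deletedEdges G G' G'⊆G) ⟨
    2 * δ + (2 * δ + 2 * δ)
      ≡⟨ six δ ⟩
    6 * δ ∎
    where
    open ≤-Reasoning
    D = deletedPairs G G'
    δ = edges G ∸ edges G'
    six : ∀ d → 2 * d + (2 * d + 2 * d) ≡ 6 * d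
    six = solve-∀
    gone : Fin N → Fin N → ℕ
    gone u v = 𝟙 (adj G u v ∧ not (adj G' u v))
    missing : Fin 3 → Fin 3 → Fin Q → Fin a → ℕ
    missing p q x i = gone (vertex p x i) (vertex q x i)
    missing-≤ : ∀ p q → (∀ x i y j → vertex p x i ≡ vertex p y j → vertex q x i ≡ vertex q y j → x ≡ y × i ≡ j) →
      sum (λ x → sum (missing p q x)) ≤ D
    missing-≤ p q injective = ∑∑-injective-≤ (vertex p) (vertex q) injective gone
    pointwise : ∀ {a b c} a' b' c' → T a → T b → T c → (T a' → T b' → T c' → ⊥) →
      1 ≤ 𝟙 (a ∧ not a') + (𝟙 (b ∧ not b') + 𝟙 (c ∧ not c'))
    pointwise {true} false b' c' _ _ _ _ = s≤s z≤n
    pointwise {true} {true} true false c' _ _ _ _ = s≤s z≤n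
    pointwise {true} {true} {true} true true false _ _ _ _ = s≤s z≤n
    pointwise {true} {true} {true} true true true _ _ _ h = ⊥-elim (h tt tt tt)
    one-missing : ∀ x i → 1 ≤ missing 0F 1F x i + (missing 1F 2F x i + missing 0F 2F x i)
    one-missing x i = pointwise (adj G' (vertex 0F x i) (vertex 1F x i))
      (adj G' (vertex 1F x i) (vertex 2F x i)) (adj G' (vertex 0F x i) (vertex 2F x i))
      (edge₀₁ x i) (edge₁₂ x i) (edge₀₂ x i)
      λ e₀₁ e₁₂ e₀₂ → copiesK≡0⇒triangleFree G' G'-free (vertex 0F x i) (vertex 1F x i) (vertex 2F x i) e₀₁ e₀₂ e₁₂

-- Sets without three-term progressions

quotient-remainder-unique : ∀ K u u' v v' → u < K → u' < K → u + K * v ≡ u' + K * v' → u ≡ u' × v ≡ v'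
quotient-remainder-unique K@(suc _) u u' v v' u<K u'<K eq = u≡u' ,
  *-cancelˡ-≡ v v' K (+-cancelˡ-≡ u _ _ (trans eq (cong (_+ K * v') (sym u≡u'))))
  where
  open ≡-Reasoning
  remainder : ∀ u v → u < K → u ≡ (u + K * v) % K
  remainder u v u<K = begin
    u                  ≡⟨ m<n⇒m%n≡m u<K ⟨
    u % K              ≡⟨ [m+kn]%n≡m%n u v K ⟨
    (u + v * K) % K    ≡⟨ cong (λ t → (u + t) % K) (*-comm v K) ⟩
    (u + K * v) % K    ∎
  u≡u' : u ≡ u'
  u≡u' = trans (remainder u v u<K) (trans (cong (_% K) eq) (sym (remainder u' v' u'<K)))

-- The parallelogram law as a quantitative form of strict convexity: the squared gap is the excess
-- over the midpoint. The absolute difference keeps it within the natural numbers, after ordering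
-- `x` and `y`.
parallelogram : ∀ x y z → x + y ≡ 2 * z → 2 * (x * x + y * y) ≡ 4 * (z * z) + ∣ x - y ∣ * ∣ x - y ∣
parallelogram x y z x+y≡2z = begin
  2 * (x * x + y * y)                              ≡⟨ law ⟩
  (x + y) * (x + y) + ∣ x - y ∣ * ∣ x - y ∣        ≡⟨ cong (λ t → t * t + ∣ x - y ∣ * ∣ x - y ∣) x+y≡2z ⟩
  (2 * z) * (2 * z) + ∣ x - y ∣ * ∣ x - y ∣        ≡⟨ cong (_+ ∣ x - y ∣ * ∣ x - y ∣) (four z) ⟩
  4 * (z * z) + ∣ x - y ∣ * ∣ x - y ∣              ∎
  where
  open ≡-Reasoning
  four : ∀ z → (2 * z) * (2 * z) ≡ 4 * (z * z)
  four = solve-∀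
  expand : ∀ x w → 2 * (x * x + (x + w) * (x + w)) ≡ (x + (x + w)) * (x + (x + w)) + w * w
  expand = solve-∀
  ordered : ∀ x y → x ≤ y → 2 * (x * x + y * y) ≡ (x + y) * (x + y) + ∣ x - y ∣ * ∣ x - y ∣
  ordered x y x≤y = subst (λ y → 2 * (x * x + y * y) ≡ (x + y) * (x + y) + ∣ x - y ∣ * ∣ x - y ∣)
    (m+[n∸m]≡n x≤y)
    (trans (expand x w) (cong (λ t → (x + (x + w)) * (x + (x + w)) + t * t) (sym (∣m-m+n∣≡n x w))))
    where w = y ∸ x
  law : 2 * (x * x + y * y) ≡ (x + y) * (x + y) + ∣ x - y ∣ * ∣ x - y ∣
  law with ≤-total x y
  ... | inj₁ x≤y = ordered x y x≤y
  ... | inj₂ y≤x = trans (cong (2 *_) (+-comm (x * x) (y * y))) (trans (ordered y x y≤x)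
    (cong₂ (λ s t → s * s + t * t) (+-comm y x) (∣-∣-comm y x)))

-- Behrend's set without the pigeonhole step: a digit vector is encoded together with its
-- squared norm, so a progression has its midpoint on the paraboloid, which is strictly convex.
-- Digits below d are read in base 2d so that adding two of them produces no carry.
module DigitVectors (d : ℕ) .{{_ : NonZero d}} where

  digit : ∀ {m} → Fin (d ^ suc m) → ℕ
  digit {m} i = toℕ (proj₁ (remQuot {d} (d ^ m) i))

  rest : ∀ {m} → Fin (d ^ suc m) → Fin (d ^ m)
  rest {m} i = proj₂ (remQuot {d} (d ^ m) i)

  digit-< : ∀ {m} (i : Fin (d ^ suc m)) → digit {m} i < d
  digit-< {m} i = toℕ<n (proj₁ (remQuot {d} (d ^ m) i))

  value norm : ∀ m → Fin (d ^ m) → ℕ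
  value zero i = 0
  value (suc m) i = digit {m} i + 2 * d * value m (rest {m} i)
  norm zero i = 0
  norm (suc m) i = digit {m} i * digit {m} i + norm m (rest {m} i)

  distance² : ∀ m → Fin (d ^ m) → Fin (d ^ m) → ℕ
  distance² zero i j = 0
  distance² (suc m) i j =
    ∣ digit {m} i - digit {m} j ∣ * ∣ digit {m} i - digit {m} j ∣ + distance² m (rest {m} i) (rest {m} j)

  value-< : ∀ m i → value m i < (2 * d) ^ m
  value-< zero i = s≤s z≤n
  value-< (suc m) i = begin-strict
    digit {m} i + 2 * d * v   <⟨ +-monoˡ-< (2 * d * v) (<-≤-trans (digit-< {m} i) (m≤n*m d 2)) ⟩
    2 * d + 2 * d * v         ≡⟨ *-suc (2 * d) v ⟨
    2 * d * suc v             ≤⟨ *-monoʳ-≤ (2 * d) (value-< m (rest {m} i)) ⟩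
    (2 * d) ^ suc m           ∎
    where
    open ≤-Reasoning
    v = value m (rest {m} i)

  norm-≤ : ∀ m i → norm m i ≤ m * (d * d)
  norm-≤ zero i = z≤n
  norm-≤ (suc m) i = +-mono-≤ (*-mono-≤ (<⇒≤ (digit-< {m} i)) (<⇒≤ (digit-< {m} i))) (norm-≤ m (rest {m} i))

  distance²≡0 : ∀ m i j → distance² m i j ≡ 0 → i ≡ j
  distance²≡0 zero zero zero _ = refl
  distance²≡0 (suc m) i j eq = begin
    i                                                     ≡⟨ combine-remQuot {d} (d ^ m) i ⟨
    combine (proj₁ (remQuot {d} (d ^ m) i)) (rest {m} i)  ≡⟨ cong₂ combine digits≡ rests≡ ⟩
    combine (proj₁ (remQuot {d} (d ^ m) j)) (rest {m} j)  ≡⟨ combine-remQuot {d} (d ^ m) j ⟩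
    j                                                     ∎
    where
    open ≡-Reasoning
    gap = ∣ digit {m} i - digit {m} j ∣
    gap≡0 : gap ≡ 0
    gap≡0 with m*n≡0⇒m≡0∨n≡0 gap (m+n≡0⇒m≡0 (gap * gap) eq)
    ... | inj₁ h = h
    ... | inj₂ h = h
    digits≡ : proj₁ (remQuot {d} (d ^ m) i) ≡ proj₁ (remQuot {d} (d ^ m) j)
    digits≡ = toℕ-injective (∣m-n∣≡0⇒m≡n gap≡0)
    rests≡ : rest {m} i ≡ rest {m} j
    rests≡ = distance²≡0 m (rest {m} i) (rest {m} j) (m+n≡0⇒n≡0 (gap * gap) eq)

  -- Without carries, a progression of values is a progression in every digit, and the parallelogram
  -- law is summed over the digits.
  midpoint-norm : ∀ m i j k → value m i + value m j ≡ 2 * value m k →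
    2 * (norm m i + norm m j) ≡ 4 * norm m k + distance² m i j
  midpoint-norm zero i j k _ = refl
  midpoint-norm (suc m) i j k eq = begin
    2 * ((x * x + norm m i') + (y * y + norm m j'))
      ≡⟨ split (x * x) (norm m i') (y * y) (norm m j') ⟩
    2 * (x * x + y * y) + 2 * (norm m i' + norm m j')
      ≡⟨ cong₂ _+_ (parallelogram x y z (proj₁ parts)) (midpoint-norm m i' j' k' (proj₂ parts)) ⟩
    (4 * (z * z) + ∣ x - y ∣ * ∣ x - y ∣) + (4 * norm m k' + distance² m i' j')
      ≡⟨ join (z * z) _ (norm m k') _ ⟩
    4 * (z * z + norm m k') + (∣ x - y ∣ * ∣ x - y ∣ + distance² m i' j') ∎
    where
    open ≡-Reasoning
    x = digit {m} i
    y = digit {m} j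
    z = digit {m} k
    i' = rest {m} i
    j' = rest {m} j
    k' = rest {m} k
    split : ∀ a b c e → 2 * ((a + b) + (c + e)) ≡ 2 * (a + c) + 2 * (b + e)
    split = solve-∀
    join : ∀ a b c e → (4 * a + b) + (4 * c + e) ≡ 4 * (a + c) + (b + e)
    join = solve-∀
    gather : ∀ x y K u v → (x + y) + K * (u + v) ≡ (x + K * u) + (y + K * v)
    gather = solve-∀
    spread : ∀ z K u → 2 * (z + K * u) ≡ 2 * z + K * (2 * u)
    spread = solve-∀
    two : ∀ x → x + x ≡ 2 * x
    two = solve-∀
    parts : x + y ≡ 2 * z × value m i' + value m j' ≡ 2 * value m k'
    parts = quotient-remainder-unique (2 * d) (x + y) (2 * z) _ _
      (<-≤-trans (+-mono-< (digit-< {m} i) (digit-< {m} j)) (≤-reflexive (two d)))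
      (*-monoʳ-< 2 (digit-< {m} k))
      (trans (gather x y (2 * d) (value m i') (value m j')) (trans eq (spread z (2 * d) (value m k'))))

  module _ (m : ℕ) where

    -- A base exceeding the sum of any two norms, so norms and values can be read off separately
    -- from a sum of two codes.
    S : ℕ
    S = (2 * m + 1) * (d * d)

    behrend : Fin (d ^ m) → ℕ
    behrend i = norm m i + S * value m i

    2*norm-< : ∀ u → u ≤ 2 * (m * (d * d)) → u < S
    2*norm-< u u≤ = begin-strict
      u                            ≤⟨ u≤ ⟩
      2 * (m * (d * d))            <⟨ m<m+n _ (>-nonZero⁻¹ (d * d) {{m*n≢0 d d}}) ⟩
      2 * (m * (d * d)) + d * d    ≡⟨ regroup m (d * d) ⟩
      S                            ∎
      where
      open ≤-Reasoning
      regroup : ∀ m D → 2 * (m * D) + D ≡ (2 * m + 1) * D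
      regroup = solve-∀

    behrend-< : ∀ i → behrend i < S * (2 * d) ^ m
    behrend-< i = begin-strict
      norm m i + S * value m i   <⟨ +-monoˡ-< (S * value m i) (2*norm-< (norm m i) (≤-trans (norm-≤ m i) (m≤n*m _ 2))) ⟩
      S + S * value m i          ≡⟨ *-suc S (value m i) ⟨
      S * suc (value m i)        ≤⟨ *-monoʳ-≤ S (value-< m i) ⟩
      S * (2 * d) ^ m            ∎
      where open ≤-Reasoning

    -- Both norm and value are in progression. Comparing the norm identity with `midpoint-norm`
    -- leaves no room for a positive distance between `i` and `j`.
    behrend-no-AP : ∀ i j k → behrend i + behrend j ≡ 2 * behrend k → i ≡ j
    behrend-no-AP i j k eq = distance²≡0 m i j (+-cancelˡ-≡ (4 * norm m k) _ _ (begin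
      4 * norm m k + distance² m i j    ≡⟨ midpoint-norm m i j k (proj₂ parts) ⟨
      2 * (norm m i + norm m j)         ≡⟨ cong (2 *_) (proj₁ parts) ⟩
      2 * (2 * norm m k)                ≡⟨ four (norm m k) ⟩
      4 * norm m k + 0                  ∎))
      where
      open ≡-Reasoning
      four : ∀ x → 2 * (2 * x) ≡ 4 * x + 0
      four = solve-∀
      gather : ∀ x y K u v → (x + y) + K * (u + v) ≡ (x + K * u) + (y + K * v)
      gather = solve-∀
      spread : ∀ z K u → 2 * (z + K * u) ≡ 2 * z + K * (2 * u)
      spread = solve-∀
      parts : norm m i + norm m j ≡ 2 * norm m k × value m i + value m j ≡ 2 * value m k
      parts = quotient-remainder-unique S (norm m i + norm m j) (2 * norm m k) _ _
        (2*norm-< _ (≤-trans (+-mono-≤ (norm-≤ m i) (norm-≤ m j)) (≤-reflexive (cong (m * (d * d) +_) (sym (+-identityʳ _))))))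
        (2*norm-< _ (*-monoʳ-≤ 2 (norm-≤ m k)))
        (trans (gather (norm m i) (norm m j) S _ _) (trans eq (spread (norm m k) S (value m k))))

-- Choice of parameters

^-distribʳ-* : ∀ k a b → (a * b) ^ k ≡ a ^ k * b ^ k
^-distribʳ-* zero a b = refl
^-distribʳ-* (suc k) a b = trans (cong (a * b *_) (^-distribʳ-* k a b)) ([m*n]*[o*p]≡[m*o]*[n*p] a b (a ^ k) (b ^ k))

interchange : ∀ x y z u → x ℚ.* y ℚ.* (z ℚ.* u) ≡ x ℚ.* z ℚ.* (y ℚ.* u)
interchange = ℚ.+-*-Solver.solve 4 (λ x y z u → x :* y :* (z :* u) := x :* z :* (y :* u)) refl
  where open ℚ.+-*-Solver

unit-fraction-^ : ∀ l k → (((ℤ.+ 1) ℚ./ suc l) ^ℚ k) ℚ.* ℕ→ℚ (suc l ^ k) ≡ 1ℚ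
unit-fraction-^ l zero = refl
unit-fraction-^ l (suc k) = begin
  ε ℚ.* (ε ^ℚ k) ℚ.* ℕ→ℚ (suc l * suc l ^ k)            ≡⟨ cong (ε ℚ.* (ε ^ℚ k) ℚ.*_) (ℕ→ℚ-* (suc l) (suc l ^ k)) ⟩
  ε ℚ.* (ε ^ℚ k) ℚ.* (ℕ→ℚ (suc l) ℚ.* ℕ→ℚ (suc l ^ k))  ≡⟨ interchange ε (ε ^ℚ k) (ℕ→ℚ (suc l)) (ℕ→ℚ (suc l ^ k)) ⟩
  ε ℚ.* ℕ→ℚ (suc l) ℚ.* ((ε ^ℚ k) ℚ.* ℕ→ℚ (suc l ^ k))  ≡⟨ cong₂ ℚ._*_ (/-cancel 1 l) (unit-fraction-^ l k) ⟩
  1ℚ                                                    ∎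
  where
  open ≡-Reasoning
  ε = (ℤ.+ 1) ℚ./ suc l

-- Here `ε` is the reciprocal of `B * (d * d)`. Large `d` makes the triangles too few for the bound
-- to be avoided, and large `B` makes the allowed deletions insufficient. The number 486 is
-- `6 * 81`: 6 from `many-deletions` and 81 from `N = 9 * Q`, squared.
module Parameters (C k m B d l : ℕ) .{{_ : NonZero d}} .{{_ : NonZero B}} (m≡ : m ≡ suc (suc k + suc k))
  (B-large : 486 * C * (2 * m + 1) * 2 ^ m < B) (1<d : 1 < d) (d-large : suc k * B ^ suc k < d)
  (L≡ : suc l ≡ B * (d * d)) where

  K L : ℕ
  K = suc k
  L = B * (d * d)
  open DigitVectors d
  Q : ℕ
  Q = S m * (2 * d) ^ m
  open RuzsaSzemerédi (behrend m) Q (behrend-< m) (behrend-no-AP m) using (N; G; few-triangles; many-deletions)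

  instance
    2d≢0 : NonZero (2 * d)
    2d≢0 = m*n≢0 2 d
    S≢0 : NonZero (S m)
    S≢0 = m*n≢0 (2 * m + 1) (d * d) {{≢-nonZero (m+1+n≢0 (2 * m))}} {{m*n≢0 d d}}
    Q≢0 : NonZero Q
    Q≢0 = m*n≢0 (S m) ((2 * d) ^ m) {{S≢0}} {{m^n≢0 (2 * d) m}}

  ε = (ℤ.+ 1) ℚ./ suc l
  ι = ℕ→ℚ

  0<ε : 0ℚ ℚ.< ε
  0<ε = ℚ.positive⁻¹ ε {{ℚ.normalize-pos 1 (suc l)}}

  1<L : 1 < suc l
  1<L = subst (1 <_) (sym L≡) (≤-trans 1<d (≤-trans (m≤n*m d d) (m≤n*m (d * d) B)))

  ε<1 : ε ℚ.< 1ℚ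
  ε<1 = ℚ.*-cancelʳ-<-nonNeg (ι (suc l)) {{ℕ→ℚ-nonNeg (suc l)}}
    (subst (ℚ._< 1ℚ ℚ.* ι (suc l)) (sym (/-cancel 1 l))
      (subst (ι 1 ℚ.<_) (sym (ℚ.*-identityˡ (ι (suc l)))) (ℕ→ℚ-mono-< 1 (suc l) 1<L)))

  degree : ∀ e → ι 0 ℚ.* ι N ℚ.≤ ι e
  degree e = subst (ℚ._≤ ι e) (sym (ℚ.*-zeroˡ (ι N))) (ℕ→ℚ-mono-≤ 0 e z≤n)

  Q≤N : Q ≤ N
  Q≤N = ≤-trans (m≤n*m Q 3) (m≤n*m (3 * Q) 3)

  -- The power contributes `d` to the exponent `2K`. Since `m = 2K + 1`, one factor `d` remains to
  -- beat `K * B ^ K`.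
  KLᴷ<N : K * suc l ^ K < N
  KLᴷ<N = begin-strict
    K * suc l ^ K                     ≡⟨ cong (λ t → K * t ^ K) L≡ ⟩
    K * (B * (d * d)) ^ K             ≡⟨ cong (K *_) (trans (^-distribʳ-* K B (d * d)) (cong (B ^ K *_) (^-distribʳ-* K d d))) ⟩
    K * (B ^ K * (d ^ K * d ^ K))     ≡⟨ *-assoc K (B ^ K) _ ⟨
    K * B ^ K * (d ^ K * d ^ K)       <⟨ *-monoˡ-< (d ^ K * d ^ K) {{m*n≢0 (d ^ K) (d ^ K) {{m^n≢0 d K}} {{m^n≢0 d K}}}} d-large ⟩
    d * (d ^ K * d ^ K)               ≡⟨ cong (d *_) (^-distribˡ-+-* d K K) ⟨
    d ^ suc (K + K)                   ≡⟨ cong (d ^_) m≡ ⟨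
    d ^ m                             ≤⟨ ^-monoˡ-≤ m (m≤n*m d 2) ⟩
    (2 * d) ^ m                       ≤⟨ m≤n*m ((2 * d) ^ m) (S m) ⟩
    Q                                 ≤⟨ Q≤N ⟩
    N                                 ∎
    where open ≤-Reasoning

  -- Multiplication by `P`, the reciprocal of `δ`, turns this into `N ^ 2 * P < N ^ 3`.
  few : ι (copiesK 3 G) ℚ.< ((ℤ.+ 1) ℚ./ suc k) ℚ.* (ε ^ℚ K) ℚ.* (ι N ^ℚ 3)
  few = ℚ.*-cancelʳ-<-nonNeg (ι P) {{ℕ→ℚ-nonNeg P}} (begin-strict
    ι (copiesK 3 G) ℚ.* ι P                        ≡⟨ ℕ→ℚ-* (copiesK 3 G) P ⟨
    ι (copiesK 3 G * P)                            <⟨ ℕ→ℚ-mono-< (copiesK 3 G * P) (N ^ 3) cP< ⟩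
    ι (N ^ 3)                                      ≡⟨ trans (sym (ℚ.*-identityˡ (ι (N ^ 3)))) (cong₂ ℚ._*_ (sym δP≡1) (sym (ℕ→ℚ-^ N 3))) ⟩
    δ ℚ.* ι P ℚ.* (ι N ^ℚ 3)                       ≡⟨ swapʳ δ (ι P) (ι N ^ℚ 3) ⟩
    δ ℚ.* (ι N ^ℚ 3) ℚ.* ι P                       ∎)
    where
    open ℚ.≤-Reasoning
    P = K * suc l ^ K
    δ = ((ℤ.+ 1) ℚ./ suc k) ℚ.* (ε ^ℚ K)
    swapʳ : ∀ x y z → x ℚ.* y ℚ.* z ≡ x ℚ.* z ℚ.* y
    swapʳ x y z = trans (ℚ.*-assoc x y z) (trans (cong (x ℚ.*_) (ℚ.*-comm y z)) (sym (ℚ.*-assoc x z y)))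
    cP< : copiesK 3 G * P < N ^ 3
    cP< = ≤-<-trans (*-monoˡ-≤ P few-triangles) (<-≤-trans
      (*-monoʳ-< (N ^ 2) {{m^n≢0 N 2 {{>-nonZero (<-≤-trans (>-nonZero⁻¹ Q) Q≤N)}}}} KLᴷ<N)
      (≤-reflexive (*-comm (N ^ 2) N)))
    δP≡1 : δ ℚ.* ι P ≡ 1ℚ
    δP≡1 = trans (cong (δ ℚ.*_) (ℕ→ℚ-* K (suc l ^ K))) (trans
      (interchange ((ℤ.+ 1) ℚ./ suc k) (ε ^ℚ K) (ι K) (ι (suc l ^ K)))
      (cong₂ ℚ._*_ (/-cancel 1 k) (unit-fraction-^ l K)))

  too-few : ∀ D → Q * d ^ m ≤ 6 * D → ι D ℚ.≤ ι C ℚ.* ε ℚ.* (ι N ^ℚ 2) → ⊥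
  too-few D QA≤ ιD≤ = <-irrefl refl (<-≤-trans B-large B≤)
    where
    open ≤-Reasoning
    swapʳ : ∀ x e z y → x ℚ.* e ℚ.* z ℚ.* y ≡ x ℚ.* z ℚ.* (e ℚ.* y)
    swapʳ = ℚ.+-*-Solver.solve 4 (λ x e z y → x :* e :* z :* y := x :* z :* (e :* y)) refl
      where open ℚ.+-*-Solver
    LD≤ : D * suc l ≤ C * N ^ 2
    LD≤ = ℕ→ℚ-cancel-≤ (D * suc l) (C * N ^ 2) (ℚ.≤-trans
      (ℚ.≤-reflexive (ℕ→ℚ-* D (suc l)))
      (ℚ.≤-trans (ℚ.*-monoʳ-≤-nonNeg (ι (suc l)) {{ℕ→ℚ-nonNeg (suc l)}} ιD≤)
        (ℚ.≤-reflexive (trans (swapʳ (ι C) ε (ι N ^ℚ 2) (ι (suc l)))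
          (trans (cong₂ (λ x y → ι C ℚ.* x ℚ.* y) (ℕ→ℚ-^ N 2) (/-cancel 1 l))
            (trans (ℚ.*-identityʳ _) (sym (ℕ→ℚ-* C (N ^ 2)))))))))
    regroup₁ : ∀ q a l → q * (a * l) ≡ (q * a) * l
    regroup₁ = solve-∀
    regroup₂ : ∀ C q → 6 * (C * ((3 * (3 * q)) * ((3 * (3 * q)) * 1))) ≡ q * (486 * C * q)
    regroup₂ = solve-∀
    regroup₃ : ∀ a b D → a * (b * D) ≡ b * (D * a)
    regroup₃ = solve-∀
    regroup₄ : ∀ C u D p a → 486 * C * ((u * D) * (p * a)) ≡ (486 * C * u * p) * (D * a)
    regroup₄ = solve-∀
    dᵐL≤ : d ^ m * L ≤ 486 * C * Q
    dᵐL≤ = *-cancelˡ-≤ Q (begin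
      Q * (d ^ m * L)           ≡⟨ regroup₁ Q (d ^ m) L ⟩
      Q * d ^ m * L             ≡⟨ cong (Q * d ^ m *_) L≡ ⟨
      Q * d ^ m * suc l         ≤⟨ *-monoˡ-≤ (suc l) QA≤ ⟩
      6 * D * suc l             ≡⟨ *-assoc 6 D (suc l) ⟩
      6 * (D * suc l)           ≤⟨ *-monoʳ-≤ 6 LD≤ ⟩
      6 * (C * N ^ 2)           ≡⟨ regroup₂ C Q ⟩
      Q * (486 * C * Q)         ∎)
    -- Expanding `Q` produces the factor `d * d * d ^ m` on both sides. Cancelling it leaves a bound
    -- free of `d`, against the choice of `B`.
    B≤ : B ≤ 486 * C * (2 * m + 1) * 2 ^ m
    B≤ = *-cancelʳ-≤ B (486 * C * (2 * m + 1) * 2 ^ m) (d * d * d ^ m) {{m*n≢0 (d * d) (d ^ m) {{m*n≢0 d d}} {{m^n≢0 d m}}}} (begin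
      B * (d * d * d ^ m)            ≡⟨ regroup₃ (d ^ m) B (d * d) ⟨
      d ^ m * L                      ≤⟨ dᵐL≤ ⟩
      486 * C * (S m * (2 * d) ^ m)  ≡⟨ cong (λ t → 486 * C * (S m * t)) (^-distribʳ-* m 2 d) ⟩
      486 * C * (S m * (2 ^ m * d ^ m)) ≡⟨ regroup₄ C (2 * m + 1) (d * d) (2 ^ m) (d ^ m) ⟩
      486 * C * (2 * m + 1) * 2 ^ m * (d * d * d ^ m) ∎)

  removal-fails : ¬ RemovalProp 3 (ι C ℚ.* ε) (ι 0) (((ℤ.+ 1) ℚ./ suc k) ℚ.* (ε ^ℚ suc k))
  removal-fails removal =
    let G' , G'⊆G , G'-free , G'-deleted = removal N G few (λ v → degree (deg G v))
    in too-few (edges G ∸ edges G') (many-deletions G' G'⊆G G'-free) G'-deleted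

no-polynomial-bound : ∀ C k → ¬ (∀ ε → 0ℚ ℚ.< ε → ε ℚ.< 1ℚ →
  RemovalProp 3 (ℕ→ℚ C ℚ.* ε) (ℕ→ℚ 0) (((ℤ.+ 1) ℚ./ suc k) ℚ.* (ε ^ℚ suc k)))
no-polynomial-bound C k removal = P.removal-fails (removal P.ε P.0<ε P.ε<1)
  where
  m B d : ℕ
  -- The order of choice matters: `m` depends on `k`, then `B` on `C` and `m`, and finally `d` on
  -- `k` and `B`.
  m = suc (suc k + suc k)
  B = suc (486 * C * (2 * m + 1) * 2 ^ m)
  d = 2 + suc k * B ^ suc k
  module P = Parameters C k m B d (pred (B * (d * d))) refl ≤-refl (s≤s (s≤s z≤n)) (m<n+m (suc k * B ^ suc k) {2} (s≤s z≤n))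
    (suc-pred (B * (d * d)))

theorem1p3 :
  (∀ (r : ℕ) → 3 ≤ r → ∀ (α : ℚ) → 0ℚ ℚ.< α →
    Σ ℚ λ C → (0ℚ ℚ.< C) × (∀ (ε : ℚ) → 0ℚ ℚ.< ε →
      δ≤δ r ε (thr r ℚ.- α) 3 (C ℚ.* ε) (ℕ→ℚ 0)))
  × (∀ (r : ℕ) → 3 ≤ r → ∀ (γ : ℚ) → γ ℚ.< thr r →
    ¬ (Σ ℕ λ k → ∀ (ε : ℚ) → 0ℚ ℚ.< ε → ε ℚ.< 1ℚ →
        RemovalProp r ε γ ((ℤ.+ 1 ℚ./ suc k) ℚ.* (ε ^ℚ suc k))))
theorem1p3 = reduction , superpolynomial
  where
  reduction : ∀ (r : ℕ) → 3 ≤ r → ∀ (α : ℚ) → 0ℚ ℚ.< α →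
    Σ ℚ λ C → (0ℚ ℚ.< C) × (∀ (ε : ℚ) → 0ℚ ℚ.< ε →
      δ≤δ r ε (thr r ℚ.- α) 3 (C ℚ.* ε) (ℕ→ℚ 0))
  reduction (suc (suc (suc s))) (s≤s (s≤s (s≤s z≤n))) α 0<α =
    let C , 0<C , reduce = removal-reduction s α 0<α
    in ℕ→ℚ C , ℕ→ℚ-mono-< 0 C 0<C , λ ε _ δ 0≤δ _ → reduce ε δ 0≤δ

  superpolynomial : ∀ (r : ℕ) → 3 ≤ r → ∀ (γ : ℚ) → γ ℚ.< thr r →
    ¬ (Σ ℕ λ k → ∀ (ε : ℚ) → 0ℚ ℚ.< ε → ε ℚ.< 1ℚ →
        RemovalProp r ε γ ((ℤ.+ 1 ℚ./ suc k) ℚ.* (ε ^ℚ suc k)))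
  superpolynomial (suc (suc (suc s))) (s≤s (s≤s (s≤s z≤n))) γ γ<thr (k , removal) =
    let C , _ , reduce = removal-reduction s α 0<α
    in no-polynomial-bound C k λ ε 0<ε ε<1 →
      reduce ε (((ℤ.+ 1) ℚ./ suc k) ℚ.* (ε ^ℚ suc k)) (nonneg ε 0<ε)
        (subst (λ γ → RemovalProp (3 + s) ε γ (((ℤ.+ 1) ℚ./ suc k) ℚ.* (ε ^ℚ suc k))) (sym thr-α≡γ) (removal ε 0<ε ε<1))
    where
    t = thr (3 + s)
    -- This `α` makes the reduced threshold equal to `γ`, so a polynomial bound for `K_r` passes to
    -- triangles with a constant `C` independent of `ε`.
    α = t ℚ.- γ
    0<α : 0ℚ ℚ.< α
    0<α = subst (ℚ._< α) (ℚ.+-inverseʳ γ) (ℚ.+-monoˡ-< (ℚ.- γ) γ<thr)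
    thr-α≡γ : t ℚ.- α ≡ γ
    thr-α≡γ = cancel t γ
      where
      open ℚ.+-*-Solver
      cancel : ∀ t γ → t ℚ.- (t ℚ.- γ) ≡ γ
      cancel = solve 2 (λ t γ → t :- (t :- γ) := γ) refl
    nonneg : ∀ ε → 0ℚ ℚ.< ε → 0ℚ ℚ.≤ ((ℤ.+ 1) ℚ./ suc k) ℚ.* (ε ^ℚ suc k)
    nonneg ε 0<ε = ℚ.<⇒≤ (ℚ.positive⁻¹ (q ℚ.* (ε ^ℚ suc k))
      {{ℚ.pos*pos⇒pos q {{ℚ.normalize-pos 1 (suc k)}} (ε ^ℚ suc k) {{power-pos (suc k)}}}})
      where
      q = (ℤ.+ 1) ℚ./ suc k
      power-pos : ∀ j → ℚ.Positive (ε ^ℚ j)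
      power-pos zero = _
      power-pos (suc j) = ℚ.pos*pos⇒pos ε {{ℚ.positive 0<ε}} (ε ^ℚ j) {{power-pos j}}
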